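{- Let $n\ge 5$ and let $F$ be a subgraph of the convex complete graph $K_n$ such that $|E(F)|=n-1$ and $F$ contains no boundary edge of $K_n$. Then $K_n-F$ admits a triangulation unless $F$ has configuration $\mathcal{J}_n(*)$ of Type-1 or of Type-2.
   Context: A convex complete graph $K_m$ is the complete graph on $m$ points in convex position in the plane, edges drawn as straight-line segments; vertices labelled $v_0,\dots,v_{m-1}$ are in cyclic order along the convex hull boundary, subscripts mod $m$. Boundary edges join boundary-consecutive vertices. Two edges with four distinct endpoints cross if their endpoints alternate along the boundary. $K_m-F$ is obtained from $K_m$ by deleting the edges of $F$ (all vertices kept). A convex graph on $m$ vertices admits a triangulation if it contains all $m$ boundary edges and $m-3$ pairwise non-crossing diagonals. $d_F(v)$ is the degree in $F$; pendant vertex = degree $1$ in $F$. Configuration $\mathcal{F}_m(*)$ ($m\ge4$): $F\subseteq K_m$ has exactly $m-2$ edges, no isolated vertices, and for some cyclic labelling either (a) $E(F)=\{v_0v_i:2\le i\le m-2\}\cup\{v_1v_{m-1}\}$, or (b) for some $2\le k\le m-4$: (i) for $0\le i\le k-1$, $d_F(v_i)\ge2$ and $v_{i-1}v_{i+1}\in E(F)$; (ii) for $k\le i\le m-1$, $d_F(v_i)=1$ and $v_i$'s neighbour in $F$ is non-pendant; (iii) if pendant vertices $u,v$ have crossing $F$-edges $uv_i$, $vv_j$, then $|i-j|=1$. Configuration $\mathcal{J}_m(*)$ ($m\ge5$): $F\subseteq K_m$ has exactly $m-1$ edges, no isolated vertices, and (i) every vertex $v_i$ with $v_{i-1}v_{i+1}\notin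 E(F)$ has $d_F(v_i)\le 2$; (ii) if $v_{i-1}v_{i+1}\notin E(F)$ and $d_F(v_i)=2$, then $F-v_i$, viewed as a subgraph of the convex complete graph $K_m-v_i$ on the remaining $m-1$ vertices (inherited cyclic order), has configuration $\mathcal{F}_{m-1}(*)$. For $k\in\{1,2\}$, $J_{m,k}$ is the set of vertices $v_i$ with $d_F(v_i)=k$ and $v_{i-1}v_{i+1}\notin E(F)$. A $\mathcal{J}_m(*)$ configuration is of Type-1 if $J_{m,2}=\emptyset$ and there is an edge $e$ of $F$ such that $F-e$ has configuration $\mathcal{F}_m(*)$. It is of Type-2 if $J_{m,2}\ne\emptyset$ and whenever $v_i\in J_{m,2}$ has $F$-neighbours $v_{j_1},v_{j_2}$ and $v_t$ is a pendant vertex of $F$ with $F$-neighbour $v_s$ such that $v_tv_s$ crosses both $v_iv_{j_1}$ and $v_iv_{j_2}$, then $|j_1-s|=1$ or $|j_2-s|=1$. -}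

module Defs where

open import Data.Bool using (Bool; true; false; _∧_; _∨_; not; if_then_else_)
open import Data.Nat using (ℕ; zero; suc; _+_; _∸_; _≤_; _<_)
open import Data.Nat.DivMod using (_%_; m%n<n)
open import Data.Fin using (Fin; zero; suc; toℕ; fromℕ<; punchIn; _≟_)
open import Data.Product using (Σ; ∃; ∃-syntax; _×_; _,_)
open import Data.Sum using (_⊎_)
open import Data.Empty using (⊥)
open import Data.List using (List; length)
open import Data.List.Relation.Unary.All using (All)
open import Data.List.Relation.Unary.AllPairs using (AllPairs)
open import Data.List.Relation.Unary.Unique.Propositional using (Unique)
open import Relation.Nullary using (¬_; does)
open import Relation.Binary.PropositionalEquality using (_≡_; _≢_)
open import Function using (_∘_; _⇔_)

-- Convex complete graph K_m: vertices Fin m, where the label toℕ i is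
-- the position of the vertex along the convex hull boundary (cyclic order).
-- A subgraph F of K_m (on all m vertices) is given by a Boolean adjacency
-- function; it is meant to be symmetric and irreflexive.

Graph : ℕ → Set
Graph m = Fin m → Fin m → Bool

E : ∀ {m} → Graph m → Fin m → Fin m → Set
E F a b = F a b ≡ true

Symmetric : ∀ {m} → Graph m → Set
Symmetric F = ∀ a b → F a b ≡ F b a

Irreflexive : ∀ {m} → Graph m → Set
Irreflexive F = ∀ a → F a a ≡ false

countB : ∀ {m} → (Fin m → Bool) → ℕ
countB {zero}  f = 0
countB {suc m} f = (if f zero then 1 else 0) + countB (f ∘ suc)

sumF : ∀ {m} → (Fin m → ℕ) → ℕ
sumF {zero}  f = 0
sumF {suc m} f = f zero + sumF (f ∘ suc)

deg : ∀ {m} → Graph m → Fin m → ℕ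
deg F v = countB (F v)

edges : ∀ {m} → Graph m → ℕ
edges F = sumF λ a → countB λ b → (toℕ a Data.Nat.<ᵇ toℕ b) ∧ F a b

shift : ∀ {m} → Fin m → ℕ → Fin m
shift {suc m} a k = fromℕ< (m%n<n (toℕ a + k) (suc m))

next : ∀ {m} → Fin m → Fin m
next a = shift a 1

prev : ∀ {m} → Fin m → Fin m
prev {m} a = shift a (m ∸ 1)

Boundary : ∀ {m} → Fin m → Fin m → Set
Boundary a b = (b ≡ next a) ⊎ (a ≡ next b)

Between : ∀ {m} → Fin m → Fin m → Fin m → Set
Between a b c = (toℕ a < toℕ c × toℕ c < toℕ b) ⊎ (toℕ b < toℕ c × toℕ c < toℕ a)

Cross : ∀ {m} → Fin m → Fin m → Fin m → Fin m → Set
Cross a b c d =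
  (a ≢ b × a ≢ c × a ≢ d × b ≢ c × b ≢ d × c ≢ d) ×
  ((Between a b c × ¬ Between a b d) ⊎ (¬ Between a b c × Between a b d))

AdmitsTriangulation : ∀ {m} → Graph m → Set
AdmitsTriangulation {m} F =
  (∀ a b → Boundary a b → ¬ E F a b) ×
  Σ (List (Fin m × Fin m)) λ T → (length T ≡ m ∸ 3 ×
          All (λ { (a , b) → toℕ a < toℕ b × ¬ Boundary a b × ¬ E F a b }) T ×
          Unique T ×
          AllPairs (λ { (a , b) (c , d) → ¬ Cross a b c d }) T)

SameEdge : ∀ {m} → Fin m → Fin m → Fin m → Fin m → Set
SameEdge a b c d = (a ≡ c × b ≡ d) ⊎ (a ≡ d × b ≡ c)

NoIsolated : ∀ {m} → Graph m → Set
NoIsolated F = ∀ v → 1 ≤ deg F v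

-- Configuration F_m(*).  A cyclic labelling is given by the vertex r = v_0;
-- then v_k = shift r k.

module _ {m : ℕ} (F : Graph m) (r : Fin m) where
  private
    v : ℕ → Fin m
    v k = shift r k

  CaseA : Set
  CaseA = ∀ a b → E F a b ⇔
            ((∃[ i ] (2 ≤ i × i ≤ m ∸ 2 × SameEdge a b (v 0) (v i)))
             ⊎ SameEdge a b (v 1) (v (m ∸ 1)))

  CaseB : Set
  CaseB = ∃[ k ] (2 ≤ k × k ≤ m ∸ 4 ×
     (∀ i → i < k → 2 ≤ deg F (v i) × E F (v (i + (m ∸ 1))) (v (i + 1))) ×
     (∀ i → k ≤ i → i < m → deg F (v i) ≡ 1 × (∀ w → E F (v i) w → deg F w ≢ 1)) ×
     (∀ u w i j → i < m → j < m → deg F u ≡ 1 → deg F w ≡ 1 →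
        E F u (v i) → E F w (v j) → Cross u (v i) w (v j) →
        (i ≡ suc j) ⊎ (j ≡ suc i)))

ConfigF : ∀ {m} → Graph m → Set
ConfigF {m} F = 4 ≤ m × edges F ≡ m ∸ 2 × NoIsolated F ×
                ∃[ r ] (CaseA F r ⊎ CaseB F r)

deleteV : ∀ {m} → Graph (suc m) → Fin (suc m) → Graph m
deleteV F i a b = F (punchIn i a) (punchIn i b)

removeEdge : ∀ {m} → Graph m → Fin m → Fin m → Graph m
removeEdge F a b x y =
  F x y ∧ not ((does (x ≟ a) ∧ does (y ≟ b)) ∨ (does (x ≟ b) ∧ does (y ≟ a)))

InJ : ∀ {m} → Graph m → ℕ → Fin m → Set
InJ F k v = deg F v ≡ k × ¬ E F (prev v) (next v)

ConfigJ : ∀ {m} → Graph m → Set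
ConfigJ {zero} F = ⊥
ConfigJ {suc m} F = 5 ≤ suc m × edges F ≡ m × NoIsolated F ×
  (∀ i → ¬ E F (prev i) (next i) → deg F i ≤ 2) ×
  (∀ i → ¬ E F (prev i) (next i) → deg F i ≡ 2 → ConfigF (deleteV F i))

Type1 : ∀ {m} → Graph m → Set
Type1 F = (∀ i → ¬ InJ F 2 i) × ∃[ a ] ∃[ b ] (E F a b × ConfigF (removeEdge F a b))

Type2 : ∀ {m} → Graph m → Set
Type2 F = (∃[ i ] InJ F 2 i) ×
  (∀ i j₁ j₂ t s → InJ F 2 i → j₁ ≢ j₂ → E F i j₁ → E F i j₂ →
     deg F t ≡ 1 → E F t s → Cross t s i j₁ → Cross t s i j₂ →
     Boundary j₁ s ⊎ Boundary j₂ s)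

{-# OPTIONS --safe #-}
-- Suppose that K_n - F has no triangulation, and call a vertex v_i tight if v_{i-1} v_{i+1} is in F.
-- Cutting off a vertex that is not tight leaves a graph without a triangulation, so induction gives
-- |E(F)| ≥ n - 2, and a vertex that is not tight has degree at most 2 when |E(F)| = n - 1 and is
-- pendant when |E(F)| = n - 2. No vertex is isolated, because of the fan at it, and the neighbour of
-- a pendant vertex is tight, because otherwise one flip repairs the fan. If all vertices that are not
-- tight are pendant, the tight vertices form one arc: two arcs would give two pendant vertices whose
-- fans share out the polygon. Two fans meeting in a common vertex also show that crossing pendant
-- edges end in neighbouring vertices, which is condition (iii) of F_n(*), and the same double fan
-- gives Type-2. In the Type-1 case a count shows that some edge inside the arc is none of the
-- v_{i-1} v_{i+1}; without it F has the shape F_n(*).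
module Submission where

open import Defs
open import Data.Bool using (Bool; true; false; T; _∧_; _∨_; not; if_then_else_)
import Data.Bool.Properties as Bool
open import Data.Empty using (⊥; ⊥-elim)
open import Data.Fin using (Fin; zero; suc; toℕ; punchIn; punchOut; _≟_)
open import Data.Fin.Properties
  using (any?; punchInᵢ≢i; punchIn-punchOut; toℕ-fromℕ<; toℕ-injective; toℕ<n)
  renaming (suc-injective to Fin-suc-injective)
open import Data.List using (List; []; _∷_; _++_; length)
open import Data.List.Properties using (length-++)
open import Data.List.Relation.Unary.All as All using (All; []; _∷_)
import Data.List.Relation.Unary.All.Properties as All
open import Data.List.Relation.Unary.AllPairs as AllPairs using (AllPairs; []; _∷_)
import Data.List.Relation.Unary.AllPairs.Properties as AllPairs
open import Data.Nat as ℕ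
  using (ℕ; zero; suc; _+_; _*_; _∸_; _≤_; _<_; z≤n; s≤s; s≤s⁻¹; _<ᵇ_; _≤‴_; ≤‴-refl; ≤‴-step)
open import Data.Nat.DivMod using (_%_; m%n<n; [m+n]%n≡m%n; m<n⇒m%n≡m; m%n%n≡m%n; %-distribˡ-+)
open import Data.Nat.Properties hiding (_≟_)
open import Data.Nat.Tactic.RingSolver using (solve-∀)
open import Data.Product using (∃-syntax; _×_; _,_; proj₁; proj₂)
open import Data.Sum using (_⊎_; inj₁; inj₂; [_,_])
open import Function using (_∘_; mk⇔)
open import Relation.Binary.Definitions using (tri<; tri≈; tri>)
open import Relation.Binary.PropositionalEquality hiding ([_])
open import Relation.Nullary using (¬_; Dec; does; yes; no)
open import Relation.Nullary.Decidable using (_×-dec_; _⊎-dec_; map′; ¬?; decidable-stable)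

-- Labels jump at vertex 0, so the proof speaks of positions, natural numbers read modulo n. Each
-- argument opens a window of n consecutive positions at a vertex of its own choice, and fans, arcs
-- and cuts become intervals. A triangulation is likewise a recursive object `Tri` over an interval,
-- independent of the side at which it is rooted; it is decidable, which makes the argument by
-- contradiction constructive. The constants come from the induction: a polygon with one vertex
-- fewer and no triangulation keeps at least n - 3 edges, so cutting off a vertex of degree d gives
-- d + (n - 3) ≤ |E(F)|. A vertex to cut off exists when n ≥ 5 and there are fewer than n edges,
-- because if all vertices were tight, the n short diagonals would be distinct edges. In a
-- quadrilateral they coincide in pairs, so small polygons need arguments of their own.

private
  variable
    m : ℕ

-- Finite sums and Boolean counts

sumF-cong : {f g : Fin m → ℕ} → (∀ i → f i ≡ g i) → sumF f ≡ sumF g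
sumF-cong {zero}  h = refl
sumF-cong {suc m} h = cong₂ _+_ (h zero) (sumF-cong (h ∘ suc))

sumF-mono : {f g : Fin m → ℕ} → (∀ i → f i ≤ g i) → sumF f ≤ sumF g
sumF-mono {zero}  h = z≤n
sumF-mono {suc m} h = +-mono-≤ (h zero) (sumF-mono (h ∘ suc))

sumF-const : ∀ m c → sumF {m} (λ _ → c) ≡ m * c
sumF-const zero    c = refl
sumF-const (suc m) c = cong (c +_) (sumF-const m c)

+-interchange : ∀ a b c d → (a + b) + (c + d) ≡ (a + c) + (b + d)
+-interchange = solve-∀

sumF-+ : (f g : Fin m → ℕ) → sumF (λ i → f i + g i) ≡ sumF f + sumF g
sumF-+ {zero}  f g = refl
sumF-+ {suc m} f g = trans (cong (f zero + g zero +_) (sumF-+ (f ∘ suc) (g ∘ suc)))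
  (+-interchange (f zero) (g zero) _ _)

sumF-*ˡ : ∀ c (f : Fin m → ℕ) → sumF (λ i → c * f i) ≡ c * sumF f
sumF-*ˡ {zero}  c f = sym (*-zeroʳ c)
sumF-*ˡ {suc m} c f = trans (cong (c * f zero +_) (sumF-*ˡ c (f ∘ suc)))
  (sym (*-distribˡ-+ c (f zero) _))

sumF-punchIn : (f : Fin (suc m) → ℕ) (i : Fin (suc m)) → sumF f ≡ f i + sumF (f ∘ punchIn i)
sumF-punchIn         f zero    = refl
sumF-punchIn {suc m} f (suc i) = trans (cong (f zero +_) (sumF-punchIn (f ∘ suc) i))
  (exchange (f zero) (f (suc i)) _)
  where
  exchange : ∀ a b c → a + (b + c) ≡ b + (a + c)
  exchange = solve-∀

sumF-last : (h : ℕ → ℕ) → sumF {suc m} (h ∘ toℕ) ≡ sumF {m} (h ∘ toℕ) + h m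
sumF-last {zero}  h = +-comm (h 0) 0
sumF-last {suc m} h = trans (cong (h 0 +_) (sumF-last {m} (h ∘ suc))) (sym (+-assoc (h 0) _ _))

sumF≤-flat : ∀ {l} (f : Fin (2 + l) → ℕ) → (∀ i → f i ≤ 1) → (∀ i → l ≤ toℕ i → f i ≡ 0) → sumF f ≤ l
sumF≤-flat {zero}  f f≤1 f≡0 rewrite f≡0 zero z≤n | f≡0 (suc zero) z≤n = z≤n
sumF≤-flat {suc l} f f≤1 f≡0 =
  +-mono-≤ (f≤1 zero) (sumF≤-flat (f ∘ suc) (f≤1 ∘ suc) (λ i → f≡0 (suc i) ∘ s≤s))

⟦_⟧ : Bool → ℕ
⟦ b ⟧ = if b then 1 else 0

countB≡sumF : (f : Fin m → Bool) → countB f ≡ sumF (λ i → ⟦ f i ⟧)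
countB≡sumF {zero}  f = refl
countB≡sumF {suc m} f = cong (⟦ f zero ⟧ +_) (countB≡sumF (f ∘ suc))

countB-cong : {f g : Fin m → Bool} → (∀ i → f i ≡ g i) → countB f ≡ countB g
countB-cong {f = f} {g} h = trans (countB≡sumF f)
  (trans (sumF-cong (cong ⟦_⟧ ∘ h)) (sym (countB≡sumF g)))

countB-mono : {f g : Fin m → Bool} → (∀ i → f i ≡ true → g i ≡ true) → countB f ≤ countB g
countB-mono {zero}          h = z≤n
countB-mono {suc m} {f} {g} h with f zero in eq
... | false = ≤-trans (countB-mono (h ∘ suc)) (m≤n+m _ _)
... | true rewrite h zero eq = s≤s (countB-mono (h ∘ suc))

countB-punchIn : (f : Fin (suc m) → Bool) (i : Fin (suc m)) →
  countB f ≡ ⟦ f i ⟧ + countB (f ∘ punchIn i)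
countB-punchIn f i = trans (countB≡sumF f) (trans (sumF-punchIn (λ j → ⟦ f j ⟧) i)
  (cong (⟦ f i ⟧ +_) (sym (countB≡sumF (f ∘ punchIn i)))))

countB-true : (f : Fin (suc m) → Bool) {i : Fin (suc m)} → f i ≡ true →
  countB f ≡ suc (countB (f ∘ punchIn i))
countB-true f {i} fi = trans (countB-punchIn f i) (cong (λ b → ⟦ b ⟧ + countB (f ∘ punchIn i)) fi)

countB-none : {f : Fin m → Bool} → (∀ i → f i ≡ false) → countB f ≡ 0
countB-none {zero}      h = refl
countB-none {suc m} {f} h rewrite h zero = countB-none (h ∘ suc)

1≤countB : {f : Fin m → Bool} {i : Fin m} → f i ≡ true → 1 ≤ countB f
1≤countB {suc m} {f} fi = subst (1 ≤_) (sym (countB-true f fi)) (s≤s z≤n)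

1≤countB⇒∃ : {f : Fin m → Bool} → 1 ≤ countB f → ∃[ i ] f i ≡ true
1≤countB⇒∃ {suc m} {f} h with f zero in eq
... | true  = zero , eq
... | false with 1≤countB⇒∃ h
...   | i , fi = suc i , fi

punchOut-true : {f : Fin (suc m) → Bool} {i j : Fin (suc m)} (i≢j : i ≢ j) → f j ≡ true →
  f (punchIn i (punchOut i≢j)) ≡ true
punchOut-true {f = f} i≢j fj = trans (cong f (punchIn-punchOut i≢j)) fj

2≤countB : {f : Fin m → Bool} {i j : Fin m} → i ≢ j → f i ≡ true → f j ≡ true → 2 ≤ countB f
2≤countB {suc m} {f} i≢j fi fj =
  subst (2 ≤_) (sym (countB-true f fi))
    (s≤s (1≤countB {f = f ∘ punchIn _} {i = punchOut i≢j} (punchOut-true {f = f} i≢j fj)))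

countB≡1-unique : {f : Fin m → Bool} {i j : Fin m} → countB f ≡ 1 → f i ≡ true → f j ≡ true → i ≡ j
countB≡1-unique {i = i} {j} one fi fj with i ≟ j
... | yes i≡j = i≡j
... | no  i≢j with s≤s () ← subst (2 ≤_) one (2≤countB i≢j fi fj)

countB≡2-cover : {f : Fin m → Bool} {i j k : Fin m} → countB f ≡ 2 → i ≢ j →
  f i ≡ true → f j ≡ true → f k ≡ true → k ≡ i ⊎ k ≡ j
countB≡2-cover {suc m} {f} {i} {j} {k} two i≢j fi fj fk with i ≟ k
... | yes i≡k = inj₁ (sym i≡k)
... | no  i≢k = inj₂ (trans (sym (punchIn-punchOut i≢k)) (trans (cong (punchIn i) eq) (punchIn-punchOut i≢j)))
  where
  eq : punchOut i≢k ≡ punchOut i≢j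
  eq = countB≡1-unique {f = f ∘ punchIn i} (suc-injective (trans (sym (countB-true f fi)) two))
         (punchOut-true {f = f} i≢k fk) (punchOut-true {f = f} i≢j fj)

countB≤1 : {f : Fin m → Bool} → (∀ i j → f i ≡ true → f j ≡ true → i ≡ j) → countB f ≤ 1
countB≤1 {zero}      h = z≤n
countB≤1 {suc m} {f} h with f zero in eq
... | false = countB≤1 (λ i j fi fj → Fin-suc-injective (h (suc i) (suc j) fi fj))
... | true  = s≤s (≤-reflexive (countB-none none))
  where
  none : ∀ i → f (suc i) ≡ false
  none i with f (suc i) in eq′
  ... | false = refl
  ... | true with () ← h zero (suc i) eq eq′

-- Edge counts through degree sums

double-injective : ∀ a b → a + a ≡ b + b → a ≡ b
double-injective a b eq = *-cancelˡ-≡ a b 2 (subst₂ _≡_ (twice a) (twice b) eq)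
  where
  twice : ∀ a → a + a ≡ 2 * a
  twice = solve-∀

-- `edges` depends on the order of the labels, the degree sum does not. Vertex deletion, edge
-- removal and rotation of the labels are therefore all compared through this identity. Induction
-- removes vertex 0, whose row and column contribute the same count `c`.
handshake : (F : Graph m) → Symmetric F → Irreflexive F → sumF (deg F) ≡ edges F + edges F
handshake {zero}  F F-sym F-irr = refl
handshake {suc m} F F-sym F-irr = begin
  deg F zero + sumF (deg F ∘ suc)
    ≡⟨ cong₂ _+_ (cong (λ b → ⟦ b ⟧ + c) (F-irr zero)) (sumF-+ (λ a → ⟦ F (suc a) zero ⟧) (deg F′)) ⟩
  c + (sumF (λ a → ⟦ F (suc a) zero ⟧) + sumF (deg F′))
    ≡⟨ cong₂ (λ x y → c + (x + y)) column (handshake F′ (λ a b → F-sym (suc a) (suc b)) (F-irr ∘ suc)) ⟩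
  c + (c + (edges F′ + edges F′))
    ≡⟨ regroup c (edges F′) ⟩
  edges F + edges F ∎
  where
  open ≡-Reasoning
  F′ : Graph m
  F′ a b = F (suc a) (suc b)
  c : ℕ
  c = countB (F zero ∘ suc)
  column : sumF (λ a → ⟦ F (suc a) zero ⟧) ≡ c
  column = trans (sumF-cong (λ a → cong ⟦_⟧ (F-sym (suc a) zero))) (sym (countB≡sumF (F zero ∘ suc)))
  regroup : ∀ c e → c + (c + (e + e)) ≡ (c + e) + (c + e)
  regroup = solve-∀

deleteV-sym : (F : Graph (suc m)) (v : Fin (suc m)) → Symmetric F → Symmetric (deleteV F v)
deleteV-sym F v F-sym a b = F-sym (punchIn v a) (punchIn v b)

edges-deleteV : (F : Graph (suc m)) (v : Fin (suc m)) → Symmetric F → Irreflexive F →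
  edges F ≡ deg F v + edges (deleteV F v)
edges-deleteV F v F-sym F-irr = double-injective _ _ (begin
  edges F + edges F
    ≡⟨ handshake F F-sym F-irr ⟨
  sumF (deg F)
    ≡⟨ sumF-punchIn (deg F) v ⟩
  deg F v + sumF (deg F ∘ punchIn v)
    ≡⟨ cong (deg F v +_) (sumF-cong (λ a → countB-punchIn (F (punchIn v a)) v)) ⟩
  deg F v + sumF (λ a → ⟦ F (punchIn v a) v ⟧ + deg F′ a)
    ≡⟨ cong (deg F v +_) (sumF-+ (λ a → ⟦ F (punchIn v a) v ⟧) (deg F′)) ⟩
  deg F v + (sumF (λ a → ⟦ F (punchIn v a) v ⟧) + sumF (deg F′))
    ≡⟨ cong₂ (λ x y → deg F v + (x + y)) column
         (handshake F′ (deleteV-sym F v F-sym) (F-irr ∘ punchIn v)) ⟩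
  deg F v + (deg F v + (edges F′ + edges F′))
    ≡⟨ regroup (deg F v) (edges F′) ⟩
  (deg F v + edges F′) + (deg F v + edges F′) ∎)
  where
  open ≡-Reasoning
  F′ = deleteV F v
  column : sumF (λ a → ⟦ F (punchIn v a) v ⟧) ≡ deg F v
  column = trans (sumF-cong (λ a → cong ⟦_⟧ (F-sym (punchIn v a) v)))
    (trans (sym (countB≡sumF (F v ∘ punchIn v)))
      (sym (trans (countB-punchIn (F v) v) (cong (λ b → ⟦ b ⟧ + countB (F v ∘ punchIn v)) (F-irr v)))))
  regroup : ∀ c e → c + (c + (e + e)) ≡ (c + e) + (c + e)
  regroup = solve-∀

removeEdge-sym : (F : Graph m) (a b : Fin m) → Symmetric F → Symmetric (removeEdge F a b)
removeEdge-sym F a b F-sym x y = cong₂ (λ p q → p ∧ not q) (F-sym x y)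
  (trans (Bool.∨-comm (does (x ≟ a) ∧ does (y ≟ b)) _)
    (cong₂ _∨_ (Bool.∧-comm (does (x ≟ b)) _) (Bool.∧-comm (does (x ≟ a)) _)))

removeEdge-irr : (F : Graph m) (a b : Fin m) → Irreflexive F → Irreflexive (removeEdge F a b)
removeEdge-irr F a b F-irr x = cong (_∧ _) (F-irr x)

removeEdge-⊆ : (F : Graph m) (a b x y : Fin m) → E (removeEdge F a b) x y → E F x y
removeEdge-⊆ F a b x y e with F x y
... | true = refl

removeEdge-other : (F : Graph m) {a b x y : Fin m} → ¬ SameEdge a b x y →
  removeEdge F a b x y ≡ F x y
removeEdge-other F {a} {b} {x} {y} ne with F x y
... | false = refl
... | true with x ≟ a | y ≟ b | x ≟ b | y ≟ a
...   | yes p | yes q | _     | _     = ⊥-elim (ne (inj₁ (sym p , sym q)))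
...   | yes p | no  q | yes r | yes s = ⊥-elim (ne (inj₂ (sym s , sym r)))
...   | yes p | no  q | yes r | no  s = refl
...   | yes p | no  q | no  r | _     = refl
...   | no  p | _     | yes r | yes s = ⊥-elim (ne (inj₂ (sym s , sym r)))
...   | no  p | _     | yes r | no  s = refl
...   | no  p | _     | no  r | _     = refl

indicator : Fin m → Fin m → ℕ
indicator a x = ⟦ does (x ≟ a) ⟧

sumF-indicator : (a : Fin m) → sumF (indicator a) ≡ 1
sumF-indicator {suc m} a = trans (sumF-punchIn (indicator a) a) (cong₂ _+_ at-a off-a)
  where
  at-a : indicator a a ≡ 1
  at-a with a ≟ a
  ... | yes _  = refl
  ... | no a≢a = ⊥-elim (a≢a refl)
  off-a : sumF (indicator a ∘ punchIn a) ≡ 0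
  off-a = trans (sumF-cong zero-at) (trans (sumF-const m 0) (*-zeroʳ m))
    where
    zero-at : ∀ j → indicator a (punchIn a j) ≡ 0
    zero-at j with punchIn a j ≟ a
    ... | yes eq = ⊥-elim (punchInᵢ≢i a j eq)
    ... | no  _  = refl

edges-removeEdge : (F : Graph m) (a b : Fin m) → Symmetric F → Irreflexive F → E F a b →
  edges F ≡ suc (edges (removeEdge F a b))
edges-removeEdge F a b F-sym F-irr ab = double-injective _ _ (begin
  edges F + edges F
    ≡⟨ handshake F F-sym F-irr ⟨
  sumF (deg F)
    ≡⟨ sumF-cong degree ⟩
  sumF (λ x → indicator a x + (indicator b x + deg F′ x))
    ≡⟨ trans (sumF-+ (indicator a) _) (cong (sumF (indicator a) +_) (sumF-+ (indicator b) (deg F′))) ⟩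
  sumF (indicator a) + (sumF (indicator b) + sumF (deg F′))
    ≡⟨ cong₂ _+_ (sumF-indicator a) (cong₂ _+_ (sumF-indicator b)
         (handshake F′ (removeEdge-sym F a b F-sym) (removeEdge-irr F a b F-irr))) ⟩
  2 + (edges F′ + edges F′)
    ≡⟨ cong suc (+-suc (edges F′) (edges F′)) ⟨
  suc (edges F′) + suc (edges F′) ∎)
  where
  open ≡-Reasoning
  F′ = removeEdge F a b
  ba : E F b a
  ba = trans (F-sym b a) ab
  a≢b : a ≢ b
  a≢b refl with () ← trans (sym ab) (F-irr a)
  -- As matrices, `F` is `F′` plus the two unit matrices at (a , b) and (b , a); row sums then give
  -- the degrees.
  entry : ∀ x y → ⟦ F x y ⟧ ≡
    indicator a x * indicator b y + (indicator b x * indicator a y + ⟦ F′ x y ⟧)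
  entry x y with x ≟ a | y ≟ b | x ≟ b | y ≟ a
  ... | yes refl | _        | yes refl | _        = ⊥-elim (a≢b refl)
  ... | _        | yes refl | _        | yes refl = ⊥-elim (a≢b refl)
  ... | yes refl | yes refl | no _     | no _     rewrite ab = refl
  ... | yes refl | no _     | no _     | yes _    = cong ⟦_⟧ (sym (Bool.∧-identityʳ _))
  ... | yes refl | no _     | no _     | no _     = cong ⟦_⟧ (sym (Bool.∧-identityʳ _))
  ... | no _     | yes _    | yes refl | no _     = cong ⟦_⟧ (sym (Bool.∧-identityʳ _))
  ... | no _     | yes _    | no _     | no _     = cong ⟦_⟧ (sym (Bool.∧-identityʳ _))
  ... | no _     | no _     | yes refl | yes refl rewrite ba = refl
  ... | no _     | no _     | yes refl | no _     = cong ⟦_⟧ (sym (Bool.∧-identityʳ _))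
  ... | no _     | no _     | no _     | _        = cong ⟦_⟧ (sym (Bool.∧-identityʳ _))
  degree : ∀ x → deg F x ≡ indicator a x + (indicator b x + deg F′ x)
  degree x = begin
    deg F x
      ≡⟨ trans (countB≡sumF (F x)) (sumF-cong (entry x)) ⟩
    sumF (λ y → indicator a x * indicator b y + (indicator b x * indicator a y + ⟦ F′ x y ⟧))
      ≡⟨ trans (sumF-+ (λ y → indicator a x * indicator b y) _)
           (cong (_ +_) (sumF-+ (λ y → indicator b x * indicator a y) _)) ⟩
    sumF (λ y → indicator a x * indicator b y) +
      (sumF (λ y → indicator b x * indicator a y) + sumF (λ y → ⟦ F′ x y ⟧))
      ≡⟨ cong₂ _+_ (scaled a b) (cong₂ _+_ (scaled b a) (sym (countB≡sumF (F′ x)))) ⟩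
    indicator a x + (indicator b x + deg F′ x) ∎
    where
    scaled : ∀ a b → sumF (λ y → indicator a x * indicator b y) ≡ indicator a x
    scaled a b = trans (sumF-*ˡ (indicator a x) (indicator b))
      (trans (cong (indicator a x *_) (sumF-indicator b)) (*-identityʳ _))

-- Positions on the boundary walk, modulo n

-- The vertex at position k of the boundary walk, so that shift r k is vtx (toℕ r + k).
opaque
  vtx : ℕ → Fin (suc m)
  vtx = shift zero

  shift≡ : (r : Fin (suc m)) (k : ℕ) → shift r k ≡ vtx (toℕ r + k)
  shift≡ r k = refl

  toℕ-vtx : ∀ k → toℕ (vtx {m} k) ≡ k % suc m
  toℕ-vtx {m} k = toℕ-fromℕ< (m%n<n k (suc m))

toℕ-vtx-< : ∀ {k} → k < suc m → toℕ (vtx {m} k) ≡ k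
toℕ-vtx-< {m} {k} k<n = trans (toℕ-vtx k) (m<n⇒m%n≡m k<n)

vtx-cong-% : ∀ {j k} → j % suc m ≡ k % suc m → vtx {m} j ≡ vtx k
vtx-cong-% {m} {j} {k} eq = toℕ-injective (trans (toℕ-vtx j) (trans eq (sym (toℕ-vtx k))))

vtx-% : ∀ {j k} → vtx {m} j ≡ vtx k → j % suc m ≡ k % suc m
vtx-% {m} {j} {k} eq = trans (sym (toℕ-vtx j)) (trans (cong toℕ eq) (toℕ-vtx k))

vtx-toℕ : (a : Fin (suc m)) → vtx (toℕ a) ≡ a
vtx-toℕ a = toℕ-injective (toℕ-vtx-< (toℕ<n a))

n+k%n : ∀ n k → (suc n + k) % suc n ≡ k % suc n
n+k%n n k = trans (cong (_% suc n) (+-comm (suc n) k)) ([m+n]%n≡m%n k (suc n))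

vtx-periodic : ∀ k → vtx {m} (suc m + k) ≡ vtx k
vtx-periodic {m} k = vtx-cong-% (n+k%n m k)

vtx-+ : ∀ d {j k} → vtx {m} j ≡ vtx k → vtx {m} (d + j) ≡ vtx (d + k)
vtx-+ {m} d {j} {k} eq = vtx-cong-% (trans (%-distribˡ-+ d j (suc m))
  (trans (cong (λ r → (d % suc m + r) % suc m) (vtx-% eq)) (sym (%-distribˡ-+ d k (suc m)))))

shift-vtx : ∀ b k → shift (vtx {m} b) k ≡ vtx (b + k)
shift-vtx b k = begin
  shift (vtx b) k       ≡⟨ shift≡ (vtx b) k ⟩
  vtx (toℕ (vtx b) + k) ≡⟨ cong vtx (+-comm _ k) ⟩
  vtx (k + toℕ (vtx b)) ≡⟨ vtx-+ k (vtx-toℕ (vtx b)) ⟩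
  vtx (k + b)           ≡⟨ cong vtx (+-comm k b) ⟩
  vtx (b + k)           ∎
  where open ≡-Reasoning

next≡ : (a : Fin (suc m)) → next a ≡ vtx (suc (toℕ a))
next≡ a = trans (shift≡ a 1) (cong vtx (+-comm (toℕ a) 1))

prev≡ : (a : Fin (suc m)) → prev a ≡ vtx (m + toℕ a)
prev≡ {m} a = trans (shift≡ a m) (cong vtx (+-comm (toℕ a) m))

-- If the vertices were equal, the residue r of j would be fixed by adding d = k - j. Without a wrap
-- this forces d = 0, with one wrap d = n, and d lies strictly between.
vtx-≢ : ∀ {j k} → j < k → k < suc m + j → vtx {m} j ≢ vtx k
vtx-≢ {m} {j} {k} j<k k<n+j eq = helper (<-≤-connex (r + d) n)
  where
  n = suc m
  d = k ∸ j
  r = j % n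
  j+d≡k : j + d ≡ k
  j+d≡k = m+[n∸m]≡n (<⇒≤ j<k)
  0<d : 0 < d
  0<d = m<n⇒0<n∸m j<k
  d<n : d < n
  d<n = +-cancelˡ-< j d n (subst₂ _<_ (sym j+d≡k) (+-comm n j) k<n+j)
  [r+d]%n≡r : (r + d) % n ≡ r
  [r+d]%n≡r = begin
    (r + d) % n       ≡⟨ %-distribˡ-+ r d n ⟩
    (r % n + d % n) % n ≡⟨ cong (λ x → (x + d % n) % n) (m%n%n≡m%n j n) ⟩
    (r + d % n) % n   ≡⟨ %-distribˡ-+ j d n ⟨
    (j + d) % n       ≡⟨ cong (_% n) j+d≡k ⟩
    k % n             ≡⟨ vtx-% eq ⟨
    r                 ∎
    where open ≡-Reasoning
  helper : r + d < n ⊎ n ≤ r + d → ⊥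
  helper (inj₁ r+d<n) = <-irrefl (sym (trans (sym (m<n⇒m%n≡m r+d<n)) [r+d]%n≡r)) (m<m+n r 0<d)
  helper (inj₂ n≤r+d) = <-irrefl d≡n d<n
    where
    e = (r + d) ∸ n
    n+e≡r+d : n + e ≡ r + d
    n+e≡r+d = m+[n∸m]≡n n≤r+d
    e<n : e < n
    e<n = +-cancelˡ-< n e n (subst (_< n + n) (sym n+e≡r+d) (+-mono-< (m%n<n j n) d<n))
    e≡r : e ≡ r
    e≡r = trans (sym (m<n⇒m%n≡m e<n)) (trans (sym (n+k%n m e)) (trans (cong (_% n) n+e≡r+d) [r+d]%n≡r))
    d≡n : d ≡ n
    d≡n = +-cancelˡ-≡ r d n (trans (sym n+e≡r+d) (trans (cong (n +_) e≡r) (+-comm n r)))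

vtx-injective : ∀ {j k} → j < suc m + k → k < suc m + j → vtx {m} j ≡ vtx k → j ≡ k
vtx-injective {j = j} {k} j<n+k k<n+j eq with <-cmp j k
... | tri< j<k _ _ = ⊥-elim (vtx-≢ j<k k<n+j eq)
... | tri≈ _ j≡k _ = j≡k
... | tri> _ _ k<j = ⊥-elim (vtx-≢ k<j j<n+k (sym eq))

-- This lets every argument choose its own starting point b. Moving the window by one step loses
-- position b and gains n + b, the same vertex.
vtx-window : ∀ b (v : Fin (suc m)) → ∃[ i ] (i ≤ m × vtx (i + b) ≡ v)
vtx-window zero    v = toℕ v , s≤s⁻¹ (toℕ<n v) , trans (cong vtx (+-identityʳ _)) (vtx-toℕ v)
vtx-window {m} (suc b) v with vtx-window b v
... | zero  , _   , eq = m , ≤-refl , trans (cong vtx (+-suc m b)) (trans (vtx-periodic b) eq)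
... | suc i , i<m , eq = i , <⇒≤ i<m , trans (cong vtx (+-suc i b)) eq

sumF-rotate : (f : Fin (suc m) → ℕ) (b : ℕ) → sumF {suc m} (λ i → f (vtx (b + toℕ i))) ≡ sumF f
sumF-rotate     f zero    = sumF-cong (λ i → cong f (vtx-toℕ i))
sumF-rotate {m} f (suc b) = trans (+-cancelʳ-≡ (h 0) _ _ step) (sumF-rotate f b)
  where
  h : ℕ → ℕ
  h i = f (vtx (b + i))
  h-periodic : h (suc m) ≡ h 0
  h-periodic = cong f (trans (cong vtx (+-comm b (suc m))) (trans (vtx-periodic b) (cong vtx (sym (+-identityʳ b)))))
  -- Both sides are the sum of `h` over the n + 1 positions 0, ..., n, with the first or the last
  -- term split off.
  step : sumF {suc m} (λ i → f (vtx (suc b + toℕ i))) + h 0 ≡ sumF {suc m} (h ∘ toℕ) + h 0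
  step = begin
    sumF {suc m} (λ i → f (vtx (suc b + toℕ i))) + h 0
      ≡⟨ cong (_+ h 0) (sumF-cong {suc m} (λ i → cong (f ∘ vtx) (sym (+-suc b (toℕ i))))) ⟩
    sumF {suc m} (h ∘ suc ∘ toℕ) + h 0 ≡⟨ +-comm _ (h 0) ⟩
    sumF {suc (suc m)} (h ∘ toℕ)       ≡⟨ sumF-last h ⟩
    sumF {suc m} (h ∘ toℕ) + h (suc m) ≡⟨ cong (sumF {suc m} (h ∘ toℕ) +_) h-periodic ⟩
    sumF {suc m} (h ∘ toℕ) + h 0       ∎
    where open ≡-Reasoning

countB-rotate : (f : Fin (suc m) → Bool) (b : ℕ) → countB {suc m} (λ i → f (vtx (b + toℕ i))) ≡ countB f
countB-rotate {m} f b = trans (countB≡sumF {suc m} (λ i → f (vtx (b + toℕ i))))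
  (trans (sumF-rotate (λ i → ⟦ f i ⟧) b) (sym (countB≡sumF f)))

-- Triangulations as recursive splittings of an interval

-- Tri H i j: the polygon on the positions i, …, j can be triangulated, where H x y ≡ false
-- is required of all its sides and diagonals except the root side (i , j).
data Tri (H : ℕ → ℕ → Bool) : ℕ → ℕ → Set where
  edge  : ∀ {i} → Tri H i (suc i)
  split : ∀ {i j} x → Tri H i x → Tri H x j → H i x ≡ false → H x j ≡ false → Tri H i j

Tri⇒< : ∀ {H i j} → Tri H i j → i < j
Tri⇒< edge              = ≤-refl
Tri⇒< (split x s t _ _) = <-trans (Tri⇒< s) (Tri⇒< t)

-- Meant for vertex deletion, which moves the positions after the deleted vertex by one. The
-- hypothesis is asked only between i and j because the two walks agree only within one window.
Tri-suc : ∀ {H H′ i j} →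
  (∀ {x y} → i ≤ x → x < y → y ≤ j → H x y ≡ false → H′ (suc x) (suc y) ≡ false) →
  Tri H i j → Tri H′ (suc i) (suc j)
Tri-suc h edge = edge
Tri-suc h (split x s t ix xj) = split (suc x)
  (Tri-suc (λ l l′ u → h l l′ (≤-trans u (<⇒≤ x<j))) s) (Tri-suc (λ l → h (≤-trans (<⇒≤ i<x) l)) t)
  (h ≤-refl i<x (<⇒≤ x<j) ix) (h (<⇒≤ i<x) x<j ≤-refl xj)
  where
  i<x = Tri⇒< s
  x<j = Tri⇒< t

-- All diagonals leave the apex i and the other sides of the triangles are boundary edges, so only
-- the row of i is inspected. The mirror image `fanʳ` peels off positions on the left, hence its
-- recursion over `≤‴`.
fanˡ : ∀ {H i j} → (∀ x → H x (suc x) ≡ false) → i < j →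
  (∀ y → i < y → y < j → H i y ≡ false) → Tri H i j
fanˡ {j = suc j} nb (s≤s i≤j) h with m≤n⇒m<n∨m≡n i≤j
... | inj₂ refl = edge
... | inj₁ i<j  = split j (fanˡ nb i<j (λ y l u → h y l (m<n⇒m<1+n u))) edge (h j i<j ≤-refl) (nb j)

fanʳ : ∀ {H i j} → (∀ x → H x (suc x) ≡ false) → i < j →
  (∀ y → i < y → y < j → H y j ≡ false) → Tri H i j
fanʳ {H} nb i<j = go (≤⇒≤‴ i<j)
  where
  go : ∀ {i j} → suc i ≤‴ j → (∀ y → i < y → y < j → H y j ≡ false) → Tri H i j
  go ≤‴-refl         h = edge
  go (≤‴-step 2+i≤j) h = split _ edge (go 2+i≤j (λ y l u → h y (<⇒≤ l) u)) (nb _) (h _ ≤-refl (≤‴⇒≤ 2+i≤j))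

Tri? : ∀ H i j → Dec (Tri H i j)
Tri? H i j = go j i j (m≤m+n j i)
  where
  -- The fuel k bounds j - i, and both parts of a split are shorter.
  go : ∀ k i j → j ≤ k + i → Dec (Tri H i j)
  go zero    i j j≤i = no (λ t → <⇒≱ (Tri⇒< t) j≤i)
  go (suc k) i j j≤k+i with j ℕ.≟ suc i
  ... | yes refl = yes edge
  ... | no  j≢1+i = map′ (λ (x , _ , s , t , ix , xj) → split x s t ix xj) unsplit
                      (anyUpTo? apex? j)
    where
    Apex : ℕ → Set
    Apex x = Tri H i x × Tri H x j × H i x ≡ false × H x j ≡ false
    unsplit : Tri H i j → ∃[ x ] (x < j × Apex x)
    unsplit edge                = ⊥-elim (j≢1+i refl)
    unsplit (split x s t ix xj) = x , Tri⇒< t , s , t , ix , xj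
    apex? : ∀ x → Dec (Apex x)
    apex? x with i <? x | x <? j
    ... | no i≮x  | _       = no (λ (s , _) → i≮x (Tri⇒< s))
    ... | yes _   | no x≮j  = no (λ (_ , t , _) → x≮j (Tri⇒< t))
    ... | yes i<x | yes x<j = go k i x (s≤s⁻¹ (≤-trans x<j j≤k+i)) ×-dec
      (go k x j (≤-trans j≤k+i (subst (_≤ k + x) (+-suc k i) (+-monoʳ-≤ k i<x))) ×-dec
        ((H i x Bool.≟ false) ×-dec (H x j Bool.≟ false)))

≢true⇒≡false : ∀ {b} → b ≢ true → b ≡ false
≢true⇒≡false = Bool.¬-not

true≢false : ∀ {b} → b ≡ true → b ≡ false → ⊥
true≢false refl ()

-- Change of root, and tight vertices

walk : Graph (suc m) → ℕ → ℕ → Bool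
walk F x y = F (vtx x) (vtx y)

NoSides : Graph (suc m) → Set
NoSides F = ∀ x → walk F x (suc x) ≡ false

Triangulable : Graph (suc m) → Set
Triangulable {m} F = Tri (walk F) 0 m

module Polygon (F : Graph (suc m)) (F-sym : Symmetric F) (sides : NoSides F) where

  n : ℕ
  n = suc m

  G : ℕ → ℕ → Bool
  G = walk F

  G-sym : ∀ x y → G x y ≡ G y x
  G-sym x y = F-sym (vtx x) (vtx y)

  G-periodicˡ : ∀ x y → G (n + x) y ≡ G x y
  G-periodicˡ x y = cong (λ v → F v (vtx y)) (vtx-periodic x)

  G-periodicʳ : ∀ x y → G x (n + y) ≡ G x y
  G-periodicʳ x y = cong (F (vtx x)) (vtx-periodic y)

  d : ℕ → ℕ
  d x = deg F (vtx x)

  d-periodic : ∀ x → d (n + x) ≡ d x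
  d-periodic x = cong (deg F) (vtx-periodic x)

  unique-neighbour : ∀ {x y z} → d x ≡ 1 → G x y ≡ true → G x z ≡ true → vtx {m} y ≡ vtx z
  unique-neighbour {x} = countB≡1-unique {f = F (vtx x)}

  Rooted : ℕ → Set
  Rooted a = Tri G a (m + a)

  flip-side : ∀ a y → G y (n + a) ≡ G a y
  flip-side a y = trans (G-periodicʳ y a) (G-sym y a)

  -- Two polygons are glued along the chord from a to x; the second one sees a as n + a. Moving the
  -- triangle over the chord from the second polygon to the first turns the chord about a, until the
  -- second polygon has shrunk to a side. `reroot-suc` turns it the other way.
  reroot : ∀ {a x} → Tri G a x → Tri G x (n + a) → G a x ≡ false → Rooted a
  reroot         t edge                ax = t
  reroot {a} {x} t (split y p q xy yn) ax = reroot (split x t p ax xy) q (trans (sym (flip-side a y)) yn)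

  reroot-suc : ∀ {a x} → Tri G a x → Tri G x (n + a) → G a x ≡ false → Tri G (suc a) (n + a)
  reroot-suc             edge                t ax = t
  reroot-suc {a} {x} (split y p q ay yx) t ax = reroot-suc p (split x q t yx (trans (flip-side a x) ax)) ay

  rooted-pred : ∀ {a} → Tri G (suc a) (n + a) → Rooted a
  rooted-pred {a} t = reroot edge t (sides a)

  rooted-suc : ∀ {a} → Rooted a → Rooted (suc a)
  rooted-suc {a} t = subst (Tri G (suc a)) (sym (+-suc m a))
    (reroot-suc t edge (trans (G-sym a (m + a)) (trans (sym (G-periodicʳ (m + a) a)) (sides (m + a)))))

  rooted⇒triangulable : ∀ a → Rooted a → Triangulable F
  rooted⇒triangulable zero    t = subst (Tri G 0) (+-identityʳ m) t
  rooted⇒triangulable (suc a) t = rooted⇒triangulable a (rooted-pred (subst (Tri G (suc a)) (+-suc m a) t))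

  triangulable⇒rooted : ∀ a → Triangulable F → Rooted a
  triangulable⇒rooted zero    t = subst (Tri G 0) (sym (+-identityʳ m)) t
  triangulable⇒rooted (suc a) t = rooted-suc (triangulable⇒rooted a t)

  cut : ∀ {a x} → Tri G a x → Tri G x (n + a) → G a x ≡ false → Triangulable F
  cut {a} s t ax = rooted⇒triangulable a (reroot s t ax)

  -- The vertex at x cannot be cut off as an ear: v_{x-1} v_{x+1} is an edge of F.
  Tight : ℕ → Set
  Tight x = G (m + x) (suc x) ≡ true

  tight? : ∀ x → Dec (Tight x)
  tight? x = G (m + x) (suc x) Bool.≟ true

  tight-suc : ∀ {x} → G x (2 + x) ≡ true → Tight (suc x)
  tight-suc {x} = trans (trans (cong (λ y → G y (2 + x)) (+-suc m x)) (G-periodicˡ x (2 + x)))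

  tight-suc⁻ : ∀ {x} → Tight (suc x) → G x (2 + x) ≡ true
  tight-suc⁻ {x} = trans (sym (trans (cong (λ y → G y (2 + x)) (+-suc m x)) (G-periodicˡ x (2 + x))))

  tight-cong : ∀ {x y} → vtx {m} x ≡ vtx y → Tight x → Tight y
  tight-cong eq = trans (sym (cong₂ F (vtx-+ m eq) (vtx-+ 1 eq)))

  -- The other ends x and x + 4 are different vertices because n ≥ 5.
  path-centre : 4 ≤ m → ∀ {x} → G x (2 + x) ≡ true → G (2 + x) (4 + x) ≡ true → 2 ≤ d (2 + x)
  path-centre 4≤m {x} e e′ = 2≤countB {f = F (vtx (2 + x))} (vtx-≢ (m<n+m x {4} (s≤s z≤n)) (+-monoˡ-< x (s≤s 4≤m)))
    (trans (G-sym (2 + x) x) e) e′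

-- Deleting a vertex and gluing an ear back on

punchIn-< : ∀ {m} (i : Fin (suc m)) (j : Fin m) → toℕ j < toℕ i → toℕ (punchIn i j) ≡ toℕ j
punchIn-< (suc i) zero    _         = refl
punchIn-< (suc i) (suc j) (s≤s j<i) = cong suc (punchIn-< i j j<i)

punchIn-≥ : ∀ {m} (i : Fin (suc m)) (j : Fin m) → toℕ i ≤ toℕ j → toℕ (punchIn i j) ≡ suc (toℕ j)
punchIn-≥ zero    j       _         = refl
punchIn-≥ (suc i) (suc j) (s≤s i≤j) = cong suc (punchIn-≥ i j i≤j)

-- Labels from c on are raised by one. Labels below c are kept, but the window starting at c reaches
-- them only after its wrap, where the larger polygon has used one more position. So the shift is by
-- one throughout.
punchIn-vtx : (c : Fin (2 + m)) {x : ℕ} → toℕ c ≤ x → x ≤ m + toℕ c →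
  punchIn c (vtx x) ≡ vtx (suc x)
punchIn-vtx {m} c {x} c≤x x≤m+c = toℕ-injective (helper (<-≤-connex x (suc m)))
  where
  helper : x < suc m ⊎ suc m ≤ x → toℕ (punchIn c (vtx x)) ≡ toℕ (vtx {suc m} (suc x))
  helper (inj₁ x≤m) = begin
    toℕ (punchIn c (vtx x)) ≡⟨ punchIn-≥ c (vtx x) (subst (toℕ c ≤_) (sym (toℕ-vtx-< x≤m)) c≤x) ⟩
    suc (toℕ (vtx {m} x))   ≡⟨ cong suc (toℕ-vtx-< x≤m) ⟩
    suc x                   ≡⟨ toℕ-vtx-< (s≤s x≤m) ⟨
    toℕ (vtx (suc x))       ∎
    where open ≡-Reasoning
  helper (inj₂ m<x) = begin
    toℕ (punchIn c (vtx x)) ≡⟨ cong (toℕ ∘ punchIn c) vtx-x ⟩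
    toℕ (punchIn c (vtx e)) ≡⟨ punchIn-< c (vtx e) (subst (_< toℕ c) (sym (toℕ-vtx-< e≤m)) e<c) ⟩
    toℕ (vtx {m} e)         ≡⟨ toℕ-vtx-< e≤m ⟩
    e                       ≡⟨ toℕ-vtx-< (m<n⇒m<1+n e≤m) ⟨
    toℕ (vtx {suc m} e)     ≡⟨ cong toℕ (vtx-periodic e) ⟨
    toℕ (vtx (2 + m + e))   ≡⟨ cong (toℕ ∘ vtx ∘ suc) 1+m+e≡x ⟩
    toℕ (vtx (suc x))       ∎
    where
    open ≡-Reasoning
    e = x ∸ suc m
    1+m+e≡x : suc m + e ≡ x
    1+m+e≡x = m+[n∸m]≡n m<x
    vtx-x : vtx {m} x ≡ vtx e
    vtx-x = trans (cong vtx (sym 1+m+e≡x)) (vtx-periodic e)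
    e<c : e < toℕ c
    e<c = +-cancelˡ-< (suc m) e (toℕ c) (subst (_< suc m + toℕ c) (sym 1+m+e≡x) (s≤s x≤m+c))
    e≤m : e < suc m
    e≤m = <-≤-trans e<c (s≤s⁻¹ (toℕ<n c))

module Ear (F : Graph (2 + m)) (F-sym : Symmetric F) (sides : NoSides F)
           (c : Fin (2 + m)) (loose : walk F (suc m + toℕ c) (suc (toℕ c)) ≡ false) where

  F′ : Graph (suc m)
  F′ = deleteV F c

  walk-deleteV : ∀ {x y} → toℕ c ≤ x → x ≤ m + toℕ c → toℕ c ≤ y → y ≤ m + toℕ c →
    walk F′ x y ≡ walk F (suc x) (suc y)
  walk-deleteV l u l′ u′ = cong₂ F (punchIn-vtx c l u) (punchIn-vtx c l′ u′)

  -- The sides of the smaller polygon are old sides, except the last one of the window, which is the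
  -- short diagonal over c and is free by `loose`.
  deleteV-sides : NoSides F′
  deleteV-sides x with vtx-window (toℕ c) (vtx {m} x)
  ... | i , i≤m , eq = subst₂ (λ v w → F′ v w ≡ false) eq (vtx-+ 1 eq) (side (m≤n⇒m<n∨m≡n i≤m))
    where
    side : i < m ⊎ i ≡ m → F′ (vtx (i + toℕ c)) (vtx (suc i + toℕ c)) ≡ false
    side (inj₁ i<m)  = trans (walk-deleteV (m≤n+m _ i) (+-monoˡ-≤ _ i≤m) (m≤n+m _ (suc i)) (+-monoˡ-≤ _ i<m))
      (sides (suc i + toℕ c))
    side (inj₂ refl) = trans (cong (F′ (vtx (m + toℕ c))) (vtx-periodic (toℕ c)))
      (trans (walk-deleteV (m≤n+m _ m) ≤-refl ≤-refl (m≤n+m _ m)) loose)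

  private
    module P  = Polygon F F-sym sides
    module P′ = Polygon F′ (deleteV-sym F c F-sym) deleteV-sides

  glue-ear : Triangulable F′ → Triangulable F
  glue-ear t = P.rooted⇒triangulable (toℕ c) (P.rooted-pred
    -- The triangulation of the smaller polygon has the short diagonal over c as its root; the ear
    -- is the triangle on this root with n + c, another position of c.
    (split (suc m + toℕ c)
      (Tri-suc (λ l x<y u xy → trans (sym (walk-deleteV l (<⇒≤ (<-≤-trans x<y u)) (≤-trans l (<⇒≤ x<y)) u)) xy)
        (P′.triangulable⇒rooted (toℕ c) t))
      edge
      (trans (P.G-sym _ _) loose)
      (sides (suc m + toℕ c))))

-- Local consequences of having no triangulation

module Untriangulable (F : Graph (2 + m)) (F-sym : Symmetric F) (F-irr : Irreflexive F)
                      (sides : NoSides F) (stuck : ¬ Triangulable F) where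

  open Polygon F F-sym sides public

  G-irr : ∀ x → G x x ≡ false
  G-irr x = F-irr (vtx x)

  no-isolated : ∀ x → 1 ≤ d x
  no-isolated a = ≮⇒≥ λ da<1 → stuck (cut {a} edge
    (fanʳ sides (s≤s (s≤s (m≤n+m a _))) (λ y _ _ → trans (flip-side a y) (alone da<1 (vtx y)))) (sides a))
    where
    alone : d a < 1 → ∀ v → F (vtx a) v ≡ false
    alone da<1 v = ≢true⇒≡false (λ av → <⇒≱ da<1 (1≤countB {f = F (vtx a)} av))

  only-before : ∀ {t z} → d t ≡ 1 → G t z ≡ true → ∀ {y} → z < y → y < n + z → G t y ≡ false
  only-before {t} {z} dt tz z<y y<n+z =
    ≢true⇒≡false (λ ty → vtx-≢ z<y y<n+z (unique-neighbour dt tz ty))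

  only-after : ∀ {t z} → d t ≡ 1 → G t z ≡ true → ∀ {y} → y < z → z < n + y → G t y ≡ false
  only-after {t} {z} dt tz y<z z<n+y =
    ≢true⇒≡false (λ ty → vtx-≢ y<z z<n+y (unique-neighbour dt ty tz))

  -- Otherwise the fan at t works after its one bad diagonal is flipped to the short diagonal at y.
  pendant-neighbour-tight : ∀ {t y} → d t ≡ 1 → G t y ≡ true → Tight y
  pendant-neighbour-tight {t} {y} dt ty with vtx-window t (vtx y)
  ... | i , i≤m , eq = tight-cong eq (helper i i≤m (trans (cong (F (vtx t)) eq) ty))
    where
    -- i is the distance from t to the neighbour. Distances 0, 1 and m + 1 would mean a loop or a
    -- side at t.
    helper : ∀ i → i ≤ suc m → G t (i + t) ≡ true → Tight (i + t)
    helper zero          _   ti = ⊥-elim (true≢false ti (G-irr t))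
    helper (suc zero)    _   ti = ⊥-elim (true≢false ti (sides t))
    helper (suc (suc i)) i<m ti with m≤n⇒m<n∨m≡n i<m
    ... | inj₂ refl = ⊥-elim (true≢false ti (trans (G-sym t _) (trans (sym (G-periodicʳ _ t)) (sides _))))
    ... | inj₁ i+1<m = tight-suc (Bool.¬-not λ loose → stuck (cut {t} {2 + z}
        (split z (fanˡ sides t<z (λ w t<w w<z → after t<w (m<n⇒m<1+n w<z)))
          (split (suc z) edge edge (sides z) (sides (suc z))) (after t<z ≤-refl) loose)
        (fanʳ sides 2+z<n+t (λ w l u → trans (flip-side t w) (before (<⇒≤ l) u)))
        (before ≤-refl 2+z<n+t)))
      where
      z = suc i + t
      t<z : t < z
      t<z = s≤s (m≤n+m t i)
      2+z<n+t : 2 + z < n + t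
      2+z<n+t = s≤s (+-monoˡ-≤ t i+1<m)
      before : ∀ {w} → suc z < w → w < n + t → G t w ≡ false
      before l u = only-before dt ti l (<-trans u (+-monoʳ-< n (m<n⇒m<1+n t<z)))
      after : ∀ {w} → t < w → w < suc z → G t w ≡ false
      after t<w u = only-after dt ti u (<-trans (<⇒≤ 2+z<n+t) (+-monoʳ-< n t<w))

  -- Fans at a and p meeting in the common vertex x.
  double-fan : ∀ {a p x} → a < p → p < x → x < n + a →
    (∀ y → a ≤ y → y ≤ x → G p y ≡ false) → (∀ y → x ≤ y → y < n + a → G a y ≡ false) → ⊥
  double-fan {a} {p} {x} a<p p<x x<n+a p-free a-free = stuck (cut {a} {x}
    (split p (fanʳ sides a<p (λ y l u → trans (G-sym y p) (p-free y (<⇒≤ l) (<⇒≤ (<-trans u p<x)))))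
             (fanˡ sides p<x (λ y l u → p-free y (<⇒≤ (<-trans a<p l)) (<⇒≤ u)))
             (trans (G-sym a p) (p-free a ≤-refl (<⇒≤ (<-trans a<p p<x)))) (p-free x (<⇒≤ (<-trans a<p p<x)) ≤-refl))
    (fanʳ sides x<n+a (λ y l u → trans (flip-side a y) (a-free y (<⇒≤ l) u)))
    (a-free x ≤-refl x<n+a))

  -- Tightness of t + 1 is the edge from t to t + 2, so t + 2 is the neighbour of the pendant vertex
  -- t.
  loose-pendant-tight : ∀ {t} → d t ≡ 1 → Tight (suc t) → Tight (2 + t)
  loose-pendant-tight dt ut = pendant-neighbour-tight dt (tight-suc⁻ ut)

  -- The pendant edges at t and t′ join t with t + 2 and t′ with t′ + 2, so the fan at t′ over
  -- the arc from t to t′ and the fan at t over the other arc avoid them.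
  unique-start : ∀ {t t′} → t < t′ → t′ < n + t → d t ≡ 1 → d t′ ≡ 1 → ¬ Tight t → ¬ Tight t′ →
    Tight (suc t) → Tight (suc t′) → ⊥
  unique-start {t} {t′} t<t′ t′<n+t dt dt′ ¬ut ¬ut′ ut ut′ = stuck (cut {t} {t′}
    (fanʳ sides t<t′ (λ y l u → trans (G-sym y t′) (t′-free (<⇒≤ l) u)))
    (fanʳ sides t′<n+t (λ y l u → trans (flip-side t y) (only-before dt (tight-suc⁻ ut) (<-trans 2+t<t′ l)
       (<-trans u (+-monoʳ-< n (m≤n+m (suc t) 1))))))
    (trans (G-sym t t′) (t′-free ≤-refl t<t′)))
    where
    -- The two vertices after a start are tight, so neither is the other start; `2+t′<n+t` says the
    -- same across the wrap.
    2+t<t′ : 2 + t < t′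
    2+t<t′ = ≤∧≢⇒< (≤∧≢⇒< t<t′ λ { refl → ¬ut′ ut }) λ { refl → ¬ut′ (loose-pendant-tight dt ut) }
    2+t′<n+t : 2 + t′ < n + t
    2+t′<n+t = ≤∧≢⇒< (≤∧≢⇒< t′<n+t λ eq → ¬ut (tight-cong (wrap eq) ut′))
                 λ eq → ¬ut (tight-cong (wrap eq) (loose-pendant-tight dt′ ut′))
      where
      wrap : ∀ {x} → x ≡ n + t → vtx {suc m} x ≡ vtx t
      wrap eq = trans (cong vtx eq) (vtx-periodic t)
    t′-free : ∀ {y} → t ≤ y → y < t′ → G t′ y ≡ false
    t′-free t≤y y<t′ = only-after dt′ (tight-suc⁻ ut′) (<-trans y<t′ (m≤n+m (suc t′) 1))
      (<-≤-trans 2+t′<n+t (+-monoʳ-≤ n t≤y))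

  -- Two pendants p < q whose edges cross, with a vertex strictly between their neighbours i < j.
  crossing-neighbours : ∀ {p q i j} → d p ≡ 1 → d q ≡ 1 → G p i ≡ true → G q j ≡ true →
    j < p → p < q → q ≤ n + i → 2 + i ≤ j → ⊥
  crossing-neighbours {p} {q} {i} {j} dp dq pi qj j<p p<q q≤n+i 2+i≤j =
    -- The fans meet at i + 1: the arc from p up to n + i + 1 stops short of n + j, and the arc from
    -- n + i + 1 to n + p begins just after n + i.
    double-fan {p} {q} {n + suc i} p<q (≤-<-trans q≤n+i n+i<x) (+-monoʳ-< n (<-trans 2+i≤j j<p))
      (λ y l u → only-before dq qj (<-≤-trans j<p l) (≤-<-trans u (+-monoʳ-< n 2+i≤j)))
      (λ y l u → only-before dp (trans (G-periodicʳ p i) pi) (<-≤-trans n+i<x l)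
        (<-trans u (+-monoʳ-< n (<-≤-trans p<q q≤n+i))))
    where
    n+i<x : n + i < n + suc i
    n+i<x = +-monoʳ-< n ≤-refl

  find-start : ∀ k {x} → ¬ Tight x → Tight (k + x) →
    ∃[ t ] (x ≤ t × t < k + x × ¬ Tight t × Tight (suc t))
  find-start zero        ¬ux ukx = ⊥-elim (¬ux ukx)
  find-start (suc k) {x} ¬ux ukx with tight? (suc x)
  ... | yes u = x , ≤-refl , s≤s (m≤n+m x k) , ¬ux , u
  ... | no ¬u with find-start k ¬u (subst Tight (sym (+-suc k x)) ukx)
  ...   | t , x<t , t<k+x , ¬ut , ut = t , <⇒≤ x<t , subst (t <_) (+-suc k x) t<k+x , ¬ut , ut

  find-end : ∀ k {x} → Tight x → ¬ Tight (k + x) →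
    ∃[ w ] (x ≤ w × w < k + x × ¬ Tight (suc w) × (∀ {y} → x ≤ y → y ≤ w → Tight y))
  find-end zero        ux ¬ukx = ⊥-elim (¬ukx ux)
  find-end (suc k) {x} ux ¬ukx with tight? (suc x)
  ... | no ¬u = x , ≤-refl , s≤s (m≤n+m x k) , ¬u , λ l u → subst Tight (≤-antisym l u) ux
  ... | yes u with find-end k u (¬ukx ∘ subst Tight (+-suc k x))
  ...   | w , x<w , w<k+x , ¬uw , tight =
      w , <⇒≤ x<w , subst (w <_) (+-suc k x) w<k+x , ¬uw , λ l y≤w → tight′ (m≤n⇒m<n∨m≡n l) y≤w
    where
    tight′ : ∀ {y} → x < y ⊎ x ≡ y → y ≤ w → Tight y
    tight′ (inj₁ x<y)  y≤w = tight x<y y≤w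
    tight′ (inj₂ refl) _   = ux

  -- All tight vertices are suc t, …, w, and the remaining vertices suc w, …, n + t are pendant.
  record TightArc : Set where
    field
      t w     : ℕ
      2+t≤w   : 2 + t ≤ w
      w<n+t   : w < n + t
      chord   : ∀ {i} → t ≤ i → i < w → G i (2 + i) ≡ true
      loose   : ∀ {p} → w < p → p ≤ n + t → ¬ Tight p
      pendant : ∀ {p} → w < p → p ≤ n + t → d p ≡ 1

    pendant-neighbour : ∀ {p} → w < p → p ≤ n + t → ∃[ j ] (suc t ≤ j × j ≤ w × G p j ≡ true)
    pendant-neighbour {p} w<p p≤n+t
      with v , pv ← 1≤countB⇒∃ {f = F (vtx p)} (≤-reflexive (sym (pendant w<p p≤n+t)))
      with i , i≤m , refl ← vtx-window (suc t) v
      = i + suc t , m≤n+m (suc t) i ,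
        ≮⇒≥ (λ w<j → loose w<j j≤n+t (pendant-neighbour-tight (pendant w<p p≤n+t) pv)) , pv
      where
      j≤n+t : i + suc t ≤ n + t
      j≤n+t = subst (_≤ n + t) (sym (+-suc i t)) (s≤s (+-monoˡ-≤ t i≤m))

  -- The neighbour of a loose, hence pendant, vertex is tight, so the walk from c to it passes a
  -- start t. A tight position beyond the end w of the arc after t would need a second start,
  -- against `unique-start`.
  tight-arc : (∀ x → ¬ Tight x → d x ≡ 1) → (∃[ c ] ¬ Tight c) → TightArc
  tight-arc loose⇒pendant (c , ¬uc)
    with v , cv ← 1≤countB⇒∃ {f = F (vtx c)} (no-isolated c)
    with i , _ , refl ← vtx-window c v
    with t , _ , _ , ¬ut , ut ← find-start i ¬uc (pendant-neighbour-tight (loose⇒pendant c ¬uc) cv)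
    with w , 1+t≤w , w<n+t , ¬uw , tight ← find-end (suc m) ut
      (λ u → ¬ut (tight-cong (vtx-periodic t) (subst Tight (+-suc (suc m) t) u)))
    = record
      { t = t ; w = w
      -- The arc has at least two vertices because the neighbour t + 2 of t is tight as well.
      ; 2+t≤w   = ≤∧≢⇒< 1+t≤w λ { refl → ¬uw (loose-pendant-tight (loose⇒pendant t ¬ut) ut) }
      ; w<n+t   = subst (w <_) (+-suc (suc m) t) w<n+t
      ; chord   = λ t≤i i<w → tight-suc⁻ (tight (s≤s t≤i) i<w)
      ; loose   = loose
      ; pendant = λ l u → loose⇒pendant _ (loose l u)
      }
    where
    loose : ∀ {p} → w < p → p ≤ n + t → ¬ Tight p
    loose {p} w<p p≤n+t up
      with t′ , w<t′ , t′<p , ¬ut′ , ut′ ← find-start (p ∸ suc w) ¬uw (subst Tight (sym (m∸n+n≡m w<p)) up)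
      = unique-start (≤-<-trans (<⇒≤ 1+t≤w) w<t′) (<-≤-trans (subst (t′ <_) (m∸n+n≡m w<p) t′<p) p≤n+t)
          (loose⇒pendant t ¬ut) (loose⇒pendant t′ ¬ut′) ¬ut ¬ut′ ut ut′

-- Crossing chords in terms of positions

module _ {m : ℕ} where
  private
    n : ℕ
    n = suc m

  -- Whether the walk from b to x passes the vertex with label 0.
  data Wrapping (b x : ℕ) : Set where
    direct  : toℕ (vtx {m} x) + b ≡ x + toℕ (vtx {m} b) → Wrapping b x
    wrapped : n + toℕ (vtx {m} x) + b ≡ x + toℕ (vtx {m} b) → Wrapping b x

  wrapping : ∀ {b x} → b ≤ x → x < n + b → Wrapping b x
  wrapping {b} {x} b≤x x<n+b = helper (<-≤-connex (ξ + β) n)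
    where
    open ≡-Reasoning
    β = toℕ (vtx {m} b)
    ξ = x ∸ b
    ξ+b≡x : ξ + b ≡ x
    ξ+b≡x = m∸n+n≡m b≤x
    ξ<n : ξ < n
    ξ<n = +-cancelʳ-< b ξ n (subst (_< n + b) (sym ξ+b≡x) x<n+b)
    vtx-x : vtx {m} x ≡ vtx (ξ + β)
    vtx-x = trans (cong vtx (sym ξ+b≡x)) (sym (vtx-+ ξ (vtx-toℕ (vtx b))))
    shuffle : ξ + β + b ≡ x + β
    shuffle = trans (+-assoc ξ β b) (trans (cong (ξ +_) (+-comm β b)) (trans (sym (+-assoc ξ b β)) (cong (_+ β) ξ+b≡x)))
    helper : ξ + β < n ⊎ n ≤ ξ + β → Wrapping b x
    helper (inj₁ <n) = direct (trans (cong (_+ b) (trans (cong toℕ vtx-x) (toℕ-vtx-< <n))) shuffle)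
    helper (inj₂ n≤) = wrapped (trans (cong (λ v → n + v + b) toℕ-x) (trans (cong (_+ b) n+e≡) shuffle))
      where
      e = (ξ + β) ∸ n
      n+e≡ : n + e ≡ ξ + β
      n+e≡ = m+[n∸m]≡n n≤
      e<n : e < n
      e<n = +-cancelˡ-< n e n (subst (_< n + n) (sym n+e≡) (+-mono-< ξ<n (toℕ<n (vtx b))))
      toℕ-x : toℕ (vtx {m} x) ≡ e
      toℕ-x = trans (cong toℕ (trans vtx-x (trans (cong vtx (sym n+e≡)) (vtx-periodic e)))) (toℕ-vtx-< e<n)

  Splits : ℕ → ℕ → ℕ → Set
  Splits s x y = (x < s × s < y) ⊎ (y < s × s < x)

  -- In the window from b, labels follow positions up to the wrap and lie below the label of b after
  -- it. Hence `Between` for the chord from b to s means a position before s if s is not wrapped,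
  -- and a position after s if it is. In both cases crossing puts x and y on different sides of s.
  cross⇒splits : ∀ {b s x y} → b < s → s < n + b → b < x → x < n + b → b < y → y < n + b →
    Cross (vtx {m} b) (vtx s) (vtx x) (vtx y) → Splits s x y
  cross⇒splits {b} {s} {x} {y} b<s s<n+b b<x x<n+b b<y y<n+b ((_ , _ , _ , s≢x , s≢y , _) , exactly-one) =
    helper (wrapping (<⇒≤ b<s) s<n+b) exactly-one
    where
    β = toℕ (vtx {m} b)
    S = toℕ (vtx {m} s)
    cancel : ∀ {u v u′ v′} c c′ → u + c ≡ u′ + c′ → v + c ≡ v′ + c′ → u < v → u′ < v′
    cancel c c′ eq eq′ u<v = +-cancelʳ-< c′ _ _ (subst₂ _<_ eq eq′ (+-monoˡ-< c u<v))
    β<direct : ∀ {z} → b < z → toℕ (vtx {m} z) + b ≡ z + β → β < toℕ (vtx {m} z)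
    β<direct {z} b<z eq = cancel β b (+-comm b β) (sym eq) b<z
    wrapped<β : ∀ {z} → z < n + b → n + toℕ (vtx {m} z) + b ≡ z + β → toℕ (vtx {m} z) < β
    wrapped<β {z} z<n+b eq = +-cancelˡ-< n _ _ (cancel β b (sym eq)
      (trans (+-assoc n b β) (trans (cong (n +_) (+-comm b β)) (sym (+-assoc n β b)))) z<n+b)
    direct<wrapped : ∀ {z z′} → toℕ (vtx {m} z) + b ≡ z + β → n + toℕ (vtx {m} z′) + b ≡ z′ + β → z < z′
    direct<wrapped {z} {z′} eq eq′ = cancel b β eq eq′ (≤-trans (toℕ<n (vtx z)) (m≤m+n n _))
    module Side {z} (b<z : b < z) (z<n+b : z < n + b) where
      B = Between (vtx {m} b) (vtx s) (vtx z)
      side : S + b ≡ s + β → Wrapping b z → (B → z < s) × (z < s → B)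
      side eq (direct eq′)  = (λ { (inj₁ (_ , lt)) → cancel b β eq′ eq lt
                                 ; (inj₂ (lt , lt′)) → ⊥-elim (<-asym (<-trans lt lt′) (β<direct b<s eq)) })
                            , λ lt → inj₁ (β<direct b<z eq′ , cancel β b (sym eq′) (sym eq) lt)
      side eq (wrapped eq′) = (λ { (inj₁ (lt , _)) → ⊥-elim (<-asym lt (wrapped<β z<n+b eq′))
                                 ; (inj₂ (lt , lt′)) → ⊥-elim (<-asym (<-trans lt lt′) (β<direct b<s eq)) })
                            , λ lt → ⊥-elim (<-asym lt (direct<wrapped {s} {z} eq eq′))
      side′ : n + S + b ≡ s + β → Wrapping b z → (B → s < z) × (s < z → B)
      side′ eq (direct eq′)  = (λ { (inj₁ (lt , lt′)) → ⊥-elim (<-asym (<-trans lt lt′) (wrapped<β s<n+b eq))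
                                  ; (inj₂ (_ , lt)) → ⊥-elim (<-asym lt (β<direct b<z eq′)) })
                             , λ lt → ⊥-elim (<-asym lt (direct<wrapped {z} {s} eq′ eq))
      side′ eq (wrapped eq′) = (λ { (inj₁ (lt , lt′)) → ⊥-elim (<-asym (<-trans lt lt′) (wrapped<β s<n+b eq))
                                  ; (inj₂ (lt , _)) → cancel b β eq eq′ (+-monoʳ-< n lt) })
                             , λ lt → inj₂ (+-cancelˡ-< n _ _ (cancel β b (sym eq) (sym eq′) lt) , wrapped<β z<n+b eq′)
      wrapping-z = wrapping (<⇒≤ b<z) z<n+b
    module X = Side b<x x<n+b
    module Y = Side b<y y<n+b
    after : ∀ {z} → vtx {m} s ≢ vtx z → ¬ z < s → s < z
    after s≢z z≮s = ≤∧≢⇒< (≮⇒≥ z≮s) λ eq → s≢z (cong vtx eq)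
    before : ∀ {z} → vtx {m} s ≢ vtx z → ¬ s < z → z < s
    before s≢z s≮z = ≤∧≢⇒< (≮⇒≥ s≮z) λ eq → s≢z (cong vtx (sym eq))
    helper : Wrapping b s → (X.B × ¬ Y.B) ⊎ (¬ X.B × Y.B) → Splits s x y
    helper (direct eq) (inj₁ (bx , ¬by)) =
      inj₁ (proj₁ (X.side eq X.wrapping-z) bx , after s≢y (¬by ∘ proj₂ (Y.side eq Y.wrapping-z)))
    helper (direct eq) (inj₂ (¬bx , by)) =
      inj₂ (proj₁ (Y.side eq Y.wrapping-z) by , after s≢x (¬bx ∘ proj₂ (X.side eq X.wrapping-z)))
    helper (wrapped eq) (inj₁ (bx , ¬by)) =
      inj₂ (before s≢y (¬by ∘ proj₂ (Y.side′ eq Y.wrapping-z)) , proj₁ (X.side′ eq X.wrapping-z) bx)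
    helper (wrapped eq) (inj₂ (¬bx , by)) =
      inj₁ (before s≢x (¬bx ∘ proj₂ (X.side′ eq X.wrapping-z)) , proj₁ (Y.side′ eq Y.wrapping-z) by)

-- Recognising the configuration F from the shape of the graph

sumF-threshold : ∀ {m} k (f : Fin m → ℕ) → k ≤ m → (∀ i → 1 ≤ f i) → (∀ i → toℕ i < k → 2 ≤ f i) →
  m + k ≤ sumF f
sumF-threshold {zero}  zero    f _         f≥1 f≥2 = z≤n
sumF-threshold {suc m} zero    f _         f≥1 f≥2 =
  +-mono-≤ (f≥1 zero) (sumF-threshold zero (f ∘ suc) z≤n (f≥1 ∘ suc) (λ _ ()))
sumF-threshold {suc m} (suc k) f (s≤s k≤m) f≥1 f≥2 = subst (_≤ sumF f) (sym (cong suc (+-suc m k)))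
  (+-mono-≤ (f≥2 zero (s≤s z≤n)) (sumF-threshold k (f ∘ suc) k≤m (f≥1 ∘ suc) (λ i i<k → f≥2 (suc i) (s≤s i<k))))

module Configuration {l : ℕ} (F : Graph (5 + l)) (F-sym : Symmetric F) (F-irr : Irreflexive F)
                     (sides : NoSides F) (size : edges F ≡ 3 + l) where

  open Polygon F F-sym sides

  positive : (∀ x → 1 ≤ d x) → NoIsolated F
  positive h v = subst (λ v → 1 ≤ deg F v) (vtx-toℕ v) (h (toℕ v))

  window : ∀ b x → ∃[ y ] (b ≤ y × y < n + b × vtx {4 + l} y ≡ vtx x)
  window b x with vtx-window b (vtx x)
  ... | i , i≤m , eq = i + b , m≤n+m b i , s≤s (+-monoˡ-≤ b i≤m) , eq

  d-cong : ∀ {x y} → vtx {4 + l} x ≡ vtx y → d x ≡ d y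
  d-cong = cong (deg F)

  -- Condition (iii) in positions: with i < j < p < q the edges from p to i and from q to j cross,
  -- so i and j must not be two or more apart.
  NonCrossing : ℕ → ℕ → ℕ → Set
  NonCrossing lo hi end = ∀ {p q i j} → hi ≤ p → p < q → q < end → lo ≤ i → j < hi →
    G p i ≡ true → G q j ≡ true → 2 + i ≤ j → ⊥

  configB : ∀ {lo hi} → 2 + lo ≤ hi → hi ≤ n + lo →
    (∀ {i} → lo ≤ i → i < hi → 2 ≤ d i × Tight i) →
    (∀ {p} → hi ≤ p → p < n + lo → d p ≡ 1 × ∃[ j ] (lo ≤ j × j < hi × G p j ≡ true)) →
    NonCrossing lo hi (n + lo) →
    ConfigF F
  configB {lo} {hi} 2+lo≤hi hi≤n+lo inner outer nested =
    s≤s (s≤s (s≤s (s≤s z≤n))) , size , positive 1≤d , vtx lo , inj₂ (k , 2≤k , k≤m-4 , core , pendants , crossings)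
    where
    k = hi ∸ lo
    k+lo≡hi : k + lo ≡ hi
    k+lo≡hi = m∸n+n≡m (≤-trans (m≤n+m lo 2) 2+lo≤hi)
    2≤k : 2 ≤ k
    2≤k = +-cancelʳ-≤ lo 2 k (subst (2 + lo ≤_) (sym k+lo≡hi) 2+lo≤hi)
    below : ∀ {i} → i < k → lo + i < hi
    below {i} i<k = subst₂ _<_ (+-comm i lo) k+lo≡hi (+-monoˡ-< lo i<k)
    above : ∀ {i} → k ≤ i → hi ≤ lo + i
    above {i} k≤i = subst₂ _≤_ k+lo≡hi (+-comm i lo) (+-monoˡ-≤ lo k≤i)
    inside : ∀ {i} → i < n → lo + i < n + lo
    inside {i} i<n = subst (_< n + lo) (+-comm i lo) (+-monoˡ-< lo i<n)
    1≤d : ∀ x → 1 ≤ d x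
    1≤d x with window lo x
    ... | y , lo≤y , y<n+lo , eq with <-≤-connex y hi
    ...   | inj₁ y<hi = subst (1 ≤_) (d-cong eq) (<⇒≤ (proj₁ (inner lo≤y y<hi)))
    ...   | inj₂ hi≤y = subst (1 ≤_) (d-cong eq) (≤-reflexive (sym (proj₁ (outer hi≤y y<n+lo))))
    -- The degree sum is 2(n - 2) = n + (n - 4). Each vertex contributes at least one and each of
    -- the k core vertices at least two.
    k≤m-4 : k ≤ suc l
    k≤m-4 = +-cancelˡ-≤ n k (suc l) (subst (n + k ≤_) total (sumF-threshold k (λ (i : Fin n) → d (lo + toℕ i))
      (+-cancelʳ-≤ lo k n (subst (_≤ n + lo) (sym k+lo≡hi) hi≤n+lo))
      (λ i → 1≤d (lo + toℕ i)) (λ i i<k → proj₁ (inner (m≤m+n lo _) (below i<k)))))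
      where
      total : sumF (λ (i : Fin n) → d (lo + toℕ i)) ≡ n + suc l
      total = trans (sumF-rotate (deg F) lo) (trans (handshake F F-sym F-irr)
        (trans (cong₂ _+_ size size) (regroup l)))
        where
        regroup : ∀ l → (3 + l) + (3 + l) ≡ (5 + l) + suc l
        regroup = solve-∀
    rearrange : ∀ lo i l → lo + (4 + l + i) ≡ 4 + l + (lo + i)
    rearrange = solve-∀
    core : ∀ i → i < k → 2 ≤ deg F (shift (vtx lo) i) ×
      E F (shift (vtx lo) (i + (n ∸ 1))) (shift (vtx lo) (i + 1))
    core i i<k rewrite shift-vtx {4 + l} lo i | shift-vtx {4 + l} lo (i + (n ∸ 1)) | shift-vtx {4 + l} lo (i + 1)
      | +-comm i (n ∸ 1) | +-comm i 1 | +-suc lo i | rearrange lo i l = inner (m≤m+n lo i) (below i<k)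
    pendants : ∀ i → k ≤ i → i < n → deg F (shift (vtx lo) i) ≡ 1 ×
      (∀ w → E F (shift (vtx lo) i) w → deg F w ≢ 1)
    pendants i k≤i i<n rewrite shift-vtx {4 + l} lo i with outer (above k≤i) (inside i<n)
    ... | one , j , lo≤j , j<hi , e = one , λ w e′ dw≡1 → <-irrefl (sym dw≡1)
      (subst (λ v → 2 ≤ deg F v) (countB≡1-unique {f = F (vtx (lo + i))} one e e′) (proj₁ (inner lo≤j j<hi)))
    -- Degree one puts v outside the core, so its only neighbour lies in the core, and both receive
    -- positions in one window.
    locate : ∀ x v → deg F v ≡ 1 → x < n → E F v (shift (vtx lo) x) →
      lo + x < hi × ∃[ p ] (hi ≤ p × p < n + lo × vtx p ≡ v × G p (lo + x) ≡ true)
    locate x v dv x<n e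
      with p , lo≤p , p<n+lo , eq ← window lo (toℕ v)
      with refl ← trans eq (vtx-toℕ v)
      rewrite shift-vtx {4 + l} lo x
      = subst (_< hi) (vtx-injective (<-≤-trans j<hi (≤-trans hi≤n+lo (+-monoʳ-≤ n (m≤m+n lo x))))
          (<-≤-trans (inside x<n) (+-monoʳ-≤ n lo≤j)) (unique-neighbour dv pj e)) j<hi ,
        p , hi≤p , p<n+lo , refl , e
      where
      hi≤p : hi ≤ p
      hi≤p = ≮⇒≥ λ p<hi → <-irrefl (sym dv) (proj₁ (inner lo≤p p<hi))
      pendant = outer hi≤p p<n+lo
      j = proj₁ (proj₂ pendant)
      lo≤j = proj₁ (proj₂ (proj₂ pendant))
      j<hi = proj₁ (proj₂ (proj₂ (proj₂ pendant)))
      pj = proj₂ (proj₂ (proj₂ (proj₂ pendant)))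
    adjacent : ∀ {i j} → i < j → ¬ (2 + i ≤ j) → j ≡ suc i
    adjacent i<j ¬2+i≤j = sym (≤∧≮⇒≡ i<j ¬2+i≤j)
    up : ∀ {i j} → 2 + i ≤ j → 2 + (lo + i) ≤ lo + j
    up {i} {j} le = subst (_≤ lo + j) (trans (+-suc lo (suc i)) (cong suc (+-suc lo i))) (+-monoʳ-≤ lo le)
    crossings : ∀ u w i j → i < n → j < n → deg F u ≡ 1 → deg F w ≡ 1 →
      E F u (shift (vtx lo) i) → E F w (shift (vtx lo) j) →
      Cross u (shift (vtx lo) i) w (shift (vtx lo) j) → i ≡ suc j ⊎ j ≡ suc i
    crossings u w i j i<n j<n du dw ui wj cross
      with i<hi , p , hi≤p , p<n+lo , refl , pi ← locate i u du i<n ui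
      with j<hi , q , hi≤q , q<n+lo , refl , qj ← locate j w dw j<n wj
      rewrite shift-vtx {4 + l} lo i | shift-vtx {4 + l} lo j
      = helper (<-cmp p q)
      where
      wrap : ∀ {x} → vtx {4 + l} x ≡ vtx (n + x)
      wrap = sym (vtx-periodic _)
      ahead : ∀ {x y} → x < n + lo → x < n + (lo + y)
      ahead {x} {y} lt = <-≤-trans lt (+-monoʳ-≤ n (m≤m+n lo y))
      i<p = <-≤-trans i<hi hi≤p
      j<p = <-≤-trans j<hi hi≤p
      helper : _ → i ≡ suc j ⊎ j ≡ suc i
      helper (tri≈ _ refl _) = ⊥-elim (proj₁ (proj₂ (proj₁ cross)) refl)
      -- In the window from p the core comes after the wrap, so the neighbours are taken one turn
      -- on. In the case q < p the vertex q is moved by a turn as well.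
      helper (tri< p<q _ _) with cross⇒splits {4 + l} {p} {n + (lo + i)} {q} {n + (lo + j)}
        (ahead p<n+lo) (+-monoʳ-< n i<p) p<q
        (<-≤-trans q<n+lo (+-monoʳ-≤ n (≤-trans (m≤m+n lo i) (<⇒≤ i<p))))
        (ahead p<n+lo) (+-monoʳ-< n j<p)
        (subst₂ (λ a b → Cross (vtx p) a (vtx q) b) wrap wrap cross)
      ... | inj₁ (_ , lt) = inj₂ (adjacent (+-cancelˡ-< lo i j (+-cancelˡ-< n _ _ lt))
              λ le → nested hi≤p p<q q<n+lo (m≤m+n lo i) j<hi pi qj (up le))
      ... | inj₂ (_ , lt) = ⊥-elim (<-asym lt (ahead q<n+lo))
      helper (tri> _ _ q<p) with cross⇒splits {4 + l} {p} {n + (lo + i)} {n + q} {n + (lo + j)}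
        (ahead p<n+lo) (+-monoʳ-< n i<p)
        (<-≤-trans p<n+lo (+-monoʳ-≤ n (≤-trans (m≤m+n lo i) (≤-trans (<⇒≤ i<hi) hi≤q))))
        (+-monoʳ-< n q<p)
        (ahead p<n+lo) (+-monoʳ-< n j<p)
        (subst₂ (λ a b → Cross (vtx p) a b (vtx (n + (lo + j)))) wrap wrap
          (subst (Cross (vtx p) (vtx (lo + i)) (vtx q)) wrap cross))
      ... | inj₁ (lt , _) = ⊥-elim (<-asym lt (+-monoʳ-< n (<-≤-trans i<hi hi≤q)))
      ... | inj₂ (lt , _) = inj₁ (adjacent (+-cancelˡ-< lo j i (+-cancelˡ-< n _ _ lt))
              λ le → nested hi≤q q<p p<n+lo (m≤m+n lo j) i<hi qj pi (up le))

  Star : Fin n → Fin n → Fin n → Set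
  Star r a b = (∃[ i ] (2 ≤ i × i ≤ n ∸ 2 × SameEdge a b (shift r 0) (shift r i))) ⊎
               SameEdge a b (shift r 1) (shift r (n ∸ 1))

  star-swap : ∀ r {a b} → Star r a b → Star r b a
  star-swap r (inj₁ (i , l , u , s)) = inj₁ (i , l , u , swap s)
    where
    swap : ∀ {a b c d : Fin n} → SameEdge a b c d → SameEdge b a c d
    swap (inj₁ (p , q)) = inj₂ (q , p)
    swap (inj₂ (p , q)) = inj₁ (q , p)
  star-swap r (inj₂ (inj₁ (p , q))) = inj₂ (inj₂ (q , p))
  star-swap r (inj₂ (inj₂ (p , q))) = inj₂ (inj₁ (q , p))

  -- This is the arc of three vertices with both ends pendant: the ends are joined to each other and
  -- the centre t + 2 takes all other edges. The centre becomes v_0, so t + 3 is v_1 and t + 1 is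
  -- v_{m-1}.
  configA : ∀ t → d (suc t) ≡ 1 → d (3 + t) ≡ 1 → G (suc t) (3 + t) ≡ true →
    (∀ {p} → 4 + t ≤ p → p ≤ n + t → d p ≡ 1 × G p (2 + t) ≡ true) → ConfigF F
  configA t d₁ d₃ g₁₃ leaf =
    s≤s (s≤s (s≤s (s≤s z≤n))) , size , positive 1≤d , r , inj₁ (λ a b → mk⇔ (star a b) (unstar a b))
    where
    r : Fin n
    r = vtx (2 + t)
    1≤d : ∀ x → 1 ≤ d x
    1≤d x with vtx-window (suc t) (vtx x)
    ... | i , i≤m , eq = subst (1 ≤_) (d-cong eq) (at i i≤m)
      where
      at : ∀ i → i ≤ 4 + l → 1 ≤ d (i + suc t)
      at 0 _ = ≤-reflexive (sym d₁)
      at 1 _ = 1≤countB {f = F r} (trans (G-sym (2 + t) (4 + t)) (proj₂ (leaf ≤-refl (+-monoˡ-≤ t (m≤m+n 4 (suc l))))))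
      at 2 _ = ≤-reflexive (sym d₃)
      at (suc (suc (suc i))) i≤m = ≤-reflexive (sym (proj₁ (leaf (+-monoˡ-≤ (suc t) (m≤m+n 3 i))
        (subst (_≤ n + t) (sym (+-suc (3 + i) t)) (s≤s (+-monoˡ-≤ t i≤m))))))
    first : vtx (3 + t) ≡ shift r 1
    first = sym (trans (shift-vtx (2 + t) 1) (cong vtx (+-comm (2 + t) 1)))
    centre : vtx (2 + t) ≡ shift r 0
    centre = sym (trans (shift-vtx (2 + t) 0) (cong vtx (+-identityʳ (2 + t))))
    last : vtx (suc t) ≡ shift r (n ∸ 1)
    last = sym (trans (shift-vtx (2 + t) (n ∸ 1)) (trans (cong vtx (rearrange t l)) (vtx-periodic (suc t))))
      where
      rearrange : ∀ t l → 2 + t + (4 + l) ≡ 5 + l + suc t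
      rearrange = solve-∀
    star-leaf : ∀ i → i ≤ 4 + l → i ≢ 1 → ∀ b → F (vtx (i + suc t)) b ≡ true → Star r (vtx (i + suc t)) b
    star-leaf 0 _ _   b e = inj₂ (inj₂ (last , trans (countB≡1-unique {f = F (vtx (suc t))} d₁ e g₁₃) first))
    star-leaf 1 _ 1≢1 b e = ⊥-elim (1≢1 refl)
    star-leaf 2 _ _   b e =
      inj₂ (inj₁ (first , trans (countB≡1-unique {f = F (vtx (3 + t))} d₃ e (trans (G-sym (3 + t) (suc t)) g₁₃)) last))
    star-leaf (suc (suc (suc i))) i≤m _ b e
      with dp , pc ← leaf {3 + i + suc t} (+-monoˡ-≤ (suc t) (m≤m+n 3 i))
                       (subst (_≤ n + t) (sym (+-suc (3 + i) t)) (s≤s (+-monoˡ-≤ t i≤m)))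
      = inj₁ (2 + i , s≤s (s≤s z≤n) , s≤s⁻¹ i≤m ,
          inj₂ (trans (cong vtx (rearrange i t)) (sym (shift-vtx (2 + t) (2 + i))) ,
                trans (countB≡1-unique {f = F (vtx (3 + i + suc t))} dp e pc) centre))
      where
      rearrange : ∀ i t → 3 + i + suc t ≡ 2 + t + (2 + i)
      rearrange = solve-∀
    star : ∀ a b → E F a b → Star r a b
    star a b e with vtx-window (suc t) a | vtx-window (suc t) b
    ... | i , i≤m , refl | j , j≤m , refl with i ℕ.≟ 1 | j ℕ.≟ 1
    ...   | no i≢1   | _        = star-leaf i i≤m i≢1 _ e
    ...   | yes refl | no j≢1   = star-swap r (star-leaf j j≤m j≢1 _ (trans (F-sym _ _) e))
    ...   | yes refl | yes refl = ⊥-elim (true≢false e (F-irr _))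
    unstar : ∀ a b → Star r a b → E F a b
    unstar a b (inj₁ (i , 2≤i , i≤ , same)) = oriented same
      where
      spoke : F (shift r 0) (shift r i) ≡ true
      spoke = trans (F-sym _ _) (trans (cong₂ F (shift-vtx (2 + t) i) (sym centre))
        (proj₂ (leaf (subst (_≤ 2 + t + i) (+-comm (2 + t) 2) (+-monoʳ-≤ (2 + t) 2≤i))
          (subst (2 + t + i ≤_) (rearrange t l) (+-monoʳ-≤ (2 + t) i≤)))))
        where
        rearrange : ∀ t l → 2 + t + (3 + l) ≡ 5 + l + t
        rearrange = solve-∀
      oriented : SameEdge a b (shift r 0) (shift r i) → E F a b
      oriented (inj₁ (refl , refl)) = spoke
      oriented (inj₂ (refl , refl)) = trans (F-sym _ _) spoke
    unstar a b (inj₂ (inj₁ (refl , refl))) = trans (F-sym _ _) (trans (cong₂ F (sym last) (sym first)) g₁₃)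
    unstar a b (inj₂ (inj₂ (refl , refl))) = trans (cong₂ F (sym last) (sym first)) g₁₃

  one-or-more : ∀ {x} → 1 ≤ d x → 2 ≤ d x ⊎ d x ≡ 1
  one-or-more {x} 1≤dx with m≤n⇒m<n∨m≡n 1≤dx
  ... | inj₁ 2≤dx = inj₁ 2≤dx
  ... | inj₂ 1≡dx = inj₂ (sym 1≡dx)

  -- The arc is suc t, …, suc w; its two ends may turn out to be pendant, and are then
  -- excluded from the core v₀, …, v_{k-1} of the configuration.
  config : ∀ {t w} → 2 + t ≤ w → w < n + t →
    (∀ {i} → t ≤ i → i < w → G i (2 + i) ≡ true) →
    (∀ {p} → w < p → p ≤ n + t → d p ≡ 1 × ∃[ j ] (suc t ≤ j × j ≤ w × G p j ≡ true)) →
    NonCrossing (suc t) (suc w) (suc (n + t)) →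
    (2 + t ≡ w → 2 ≤ d (suc t) × 2 ≤ d w) →
    ConfigF F
  config {t} {w} 2+t≤w w<n+t chord outer nested small
    with x , refl ← m≤n⇒∃[o]m+o≡n (≤-trans (m≤m+n 2 t) 2+t≤w)
    = ends (one-or-more (1≤countB {f = F (vtx (suc t))} first-chord))
           (one-or-more (1≤countB {f = F (vtx (2 + x))} last-chord))
    where
    t≤x : t ≤ x
    t≤x = s≤s⁻¹ (s≤s⁻¹ 2+t≤w)
    first-chord : G (suc t) (3 + t) ≡ true
    first-chord = chord (n≤1+n t) 2+t≤w
    last-chord : G (2 + x) x ≡ true
    last-chord = trans (G-sym (2 + x) x) (chord t≤x (m≤n+m (suc x) 1))

    First Last : ℕ → Set
    First lo = (lo ≡ suc t × 2 ≤ d (suc t)) ⊎ (lo ≡ 2 + t × d (suc t) ≡ 1)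
    Last  hi = (hi ≡ 3 + x × 2 ≤ d (2 + x)) ⊎ (hi ≡ 2 + x × d (2 + x) ≡ 1)

    first≤ : ∀ {lo} → First lo → suc t ≤ lo
    first≤ (inj₁ (refl , _)) = ≤-refl
    first≤ (inj₂ (refl , _)) = n≤1+n _
    last≤ : ∀ {hi} → Last hi → hi ≤ 3 + x
    last≤ (inj₁ (refl , _)) = ≤-refl
    last≤ (inj₂ (refl , _)) = n≤1+n _

    -- The only edge at a dropped end is its short diagonal, so no outer pendant vertex is attached
    -- to it.
    not-first : ∀ {lo} → First lo → ∀ {p j} → suc t ≤ j → 2 + lo ≤ p → p ≤ n + t → G p j ≡ true → lo ≤ j
    not-first (inj₁ (refl , _))  1+t≤j _     _     _  = 1+t≤j
    not-first (inj₂ (refl , d₁)) {p} 1+t≤j 3+t<p p≤n+t pj = ≤∧≢⇒< 1+t≤j λ { refl →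
      vtx-≢ 3+t<p (≤-<-trans p≤n+t (+-monoʳ-< n (m≤n+m (suc t) 2)))
        (unique-neighbour d₁ first-chord (trans (G-sym (suc t) p) pj)) }

    not-last : ∀ {hi} → Last hi → ∀ {p j} → j ≤ 2 + x → 3 + t ≤ hi → 2 + x < p → p ≤ n + t → G p j ≡ true → j < hi
    not-last (inj₁ (refl , _))  j≤w _ _ _ _ = s≤s j≤w
    not-last (inj₂ (refl , d₂)) {p} j≤w 3+t≤hi w<p p≤n+t pj = ≤∧≢⇒< j≤w λ { refl →
      vtx-≢ (≤-trans (m≤n+m (suc x) 2) w<p) (≤-<-trans p≤n+t (+-monoʳ-< n (s≤s⁻¹ (s≤s⁻¹ 3+t≤hi))))
        (unique-neighbour d₂ last-chord (trans (G-sym (2 + x) p) pj)) }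

    interior : ∀ {i} → t < i → suc i < 2 + x → 2 ≤ d (suc i)
    interior {suc i} (s≤s t≤i) i<x = path-centre (s≤s (s≤s (s≤s (s≤s z≤n))))
      (chord t≤i (≤-trans (m≤n+m (suc i) 2) i<x)) (chord (≤-trans t≤i (m≤n+m i 2)) i<x)

    assemble : ∀ {lo hi} → First lo → Last hi → 2 + lo ≤ hi → ConfigF F
    assemble {lo} {hi} first last 2+lo≤hi =
      configB 2+lo≤hi hi≤n+lo inner outer′ nested′
      where
      hi≤n+lo : hi ≤ n + lo
      hi≤n+lo = ≤-trans (last≤ last) (≤-trans w<n+t (+-monoʳ-≤ n (<⇒≤ (first≤ first))))
      3+t≤hi : 3 + t ≤ hi
      3+t≤hi = ≤-trans (s≤s (s≤s (first≤ first))) 2+lo≤hi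
      inner : ∀ {i} → lo ≤ i → i < hi → 2 ≤ d i × Tight i
      inner {zero}  lo≤0 _    = ⊥-elim (<⇒≱ (first≤ first) (≤-trans lo≤0 z≤n))
      inner {suc i} lo≤i i<hi = degree , tight-suc (chord t≤i i<w)
        where
        t≤i : t ≤ i
        t≤i = s≤s⁻¹ (≤-trans (first≤ first) lo≤i)
        i<w : i < 2 + x
        i<w = s≤s⁻¹ (≤-trans i<hi (last≤ last))
        degree : 2 ≤ d (suc i)
        degree with m≤n⇒m<n∨m≡n t≤i | m≤n⇒m<n∨m≡n i<w
        ... | inj₂ refl | _ = at-first first
          where
          at-first : First lo → 2 ≤ d (suc t)
          at-first (inj₁ (_ , 2≤d))   = 2≤d
          at-first (inj₂ (refl , _)) = ⊥-elim (<-irrefl refl lo≤i)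
        ... | inj₁ _ | inj₂ refl = at-last last
          where
          at-last : Last hi → 2 ≤ d (2 + x)
          at-last (inj₁ (_ , 2≤d))   = 2≤d
          at-last (inj₂ (refl , _)) = ⊥-elim (<-irrefl refl i<hi)
        ... | inj₁ t<i | inj₁ i<x = interior t<i i<x
      outer′ : ∀ {p} → hi ≤ p → p < n + lo → d p ≡ 1 × ∃[ j ] (lo ≤ j × j < hi × G p j ≡ true)
      -- The outer range has gained the dropped ends: w on the left, and t + 1 one turn on at the
      -- right.
      outer′ {p} hi≤p p<n+lo with <-≤-connex p (3 + x) | <-≤-connex (n + t) p
      ... | inj₁ p≤w | _ = at-last last
        where
        at-last : Last hi → d p ≡ 1 × ∃[ j ] (lo ≤ j × j < hi × G p j ≡ true)
        at-last (inj₁ (refl , _)) = ⊥-elim (<⇒≱ p≤w hi≤p)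
        at-last (inj₂ (refl , d₂)) with refl ← ≤-antisym (s≤s⁻¹ p≤w) hi≤p =
          d₂ , x , s≤s⁻¹ (s≤s⁻¹ 2+lo≤hi) , m≤n+m (suc x) 1 , last-chord
      ... | inj₂ _ | inj₁ n+t<p = at-first first
        where
        at-first : First lo → d p ≡ 1 × ∃[ j ] (lo ≤ j × j < hi × G p j ≡ true)
        at-first (inj₁ (refl , _)) = ⊥-elim (<⇒≱ p<n+lo (subst (_≤ p) (sym (+-suc n t)) n+t<p))
        at-first (inj₂ (refl , d₁))
          with refl ← ≤-antisym (s≤s⁻¹ (subst (p <_) (+-suc n (suc t)) p<n+lo)) (subst (_≤ p) (sym (+-suc n t)) n+t<p) =
          trans (d-periodic (suc t)) d₁ , 3 + t , n≤1+n _ , 2+lo≤hi , trans (G-periodicˡ (suc t) (3 + t)) first-chord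
      ... | inj₂ w<p | inj₂ p≤n+t with outer w<p p≤n+t
      ...   | dp , j , 1+t≤j , j≤w , pj = dp , j , not-first first 1+t≤j (≤-trans 2+lo≤hi hi≤p) p≤n+t pj ,
          not-last last j≤w 3+t≤hi w<p p≤n+t pj , pj
      nested′ : NonCrossing lo hi (n + lo)
      -- A dropped end is joined to the second core position from its side, so the other neighbour
      -- would have to lie outside the core.
      nested′ {p} {q} {i} {j} hi≤p p<q q<n+lo lo≤i j<hi pi qj 2+i≤j
        with <-≤-connex p (3 + x) | <-≤-connex (n + t) q
      ... | inj₁ p≤w | _ = at-last last
        where
        at-last : Last hi → ⊥
        at-last (inj₁ (refl , _)) = <⇒≱ p≤w hi≤p
        at-last (inj₂ (refl , d₂)) with refl ← ≤-antisym (s≤s⁻¹ p≤w) hi≤p = <⇒≱ j<hi (subst (λ y → 2 + y ≤ j) i≡x 2+i≤j)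
          where
          i≡x : i ≡ x
          i≡x = vtx-injective (≤-trans (s≤s⁻¹ (s≤s⁻¹ (≤-trans (s≤s 2+i≤j) j<hi))) (m≤n+m x n))
            (<-≤-trans (≤-<-trans (m≤n+m x 2) w<n+t) (+-monoʳ-≤ n (≤-trans (<⇒≤ (first≤ first)) lo≤i)))
            (unique-neighbour d₂ pi last-chord)
      ... | inj₂ _ | inj₁ n+t<q = at-first first
        where
        at-first : First lo → ⊥
        at-first (inj₁ (refl , _)) = <⇒≱ q<n+lo (subst (_≤ q) (sym (+-suc n t)) n+t<q)
        at-first (inj₂ (refl , d₁))
          with refl ← ≤-antisym (s≤s⁻¹ (subst (q <_) (+-suc n (suc t)) q<n+lo)) (subst (_≤ q) (sym (+-suc n t)) n+t<q) =
          vtx-≢ (≤-trans (s≤s (s≤s lo≤i)) 2+i≤j)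
            (<-trans (≤-<-trans (s≤s⁻¹ (≤-trans j<hi (last≤ last))) w<n+t) (+-monoʳ-< n (m≤n+m (suc t) 2)))
            (unique-neighbour d₁ first-chord (trans (sym (G-periodicˡ (suc t) j)) qj))
      ... | inj₂ w<p | inj₂ q≤n+t =
        nested w<p p<q (s≤s q≤n+t) (≤-trans (first≤ first) lo≤i) (≤-trans j<hi (last≤ last)) pi qj 2+i≤j

    -- Case (b) needs a core of at least two vertices. An arc of two loses no end, by `small`; an
    -- arc of three that loses both is case (a).
    ends : 2 ≤ d (suc t) ⊎ d (suc t) ≡ 1 → 2 ≤ d (2 + x) ⊎ d (2 + x) ≡ 1 → ConfigF F
    ends (inj₁ 2≤d₁) (inj₁ 2≤d₂) = assemble (inj₁ (refl , 2≤d₁)) (inj₁ (refl , 2≤d₂)) (s≤s 2+t≤w)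
    ends (inj₂ d₁) last with m≤n⇒m<n∨m≡n 2+t≤w
    ends (inj₂ d₁) last | inj₂ eq = ⊥-elim (<-irrefl (sym d₁) (proj₁ (small eq)))
    ends (inj₂ d₁) (inj₁ 2≤d₂) | inj₁ 3+t≤w = assemble (inj₂ (refl , d₁)) (inj₁ (refl , 2≤d₂)) (s≤s 3+t≤w)
    ends (inj₂ d₁) (inj₂ d₂)   | inj₁ 3+t≤w with m≤n⇒m<n∨m≡n 3+t≤w
    ... | inj₁ 4+t≤w = assemble (inj₂ (refl , d₁)) (inj₂ (refl , d₂)) 4+t≤w
    ... | inj₂ refl  = configA t d₁ d₂ first-chord leaf
      where
      leaf : ∀ {p} → 4 + t ≤ p → p ≤ n + t → d p ≡ 1 × G p (2 + t) ≡ true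
      leaf {p} l u with outer l u
      ... | dp , j , 1+t≤j , j≤w , pj = dp , subst (λ j → G p j ≡ true) j≡2+t pj
        where
        j≡2+t : j ≡ 2 + t
        j≡2+t = ≤-antisym (s≤s⁻¹ (not-last (inj₂ (refl , d₂)) j≤w ≤-refl l u pj))
          (not-first (inj₂ (refl , d₁)) 1+t≤j l u pj)
    ends (inj₁ 2≤d₁) (inj₂ d₂) with m≤n⇒m<n∨m≡n 2+t≤w
    ... | inj₁ 3+t≤w = assemble (inj₁ (refl , 2≤d₁)) (inj₂ (refl , d₂)) 3+t≤w
    ... | inj₂ eq    = ⊥-elim (<-irrefl (sym d₂) (proj₂ (small eq)))

-- From splittings to lists of diagonals

module Diagonals {m : ℕ} (F : Graph (3 + m)) (F-sym : Symmetric F) (sides : NoSides F) where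

  open Polygon F F-sym sides

  Chord : Set
  Chord = Fin n × Fin n

  chords : ∀ {i j} → Tri G i j → List Chord
  chords             edge              = []
  chords {i} {j} (split x s t _ _) = (vtx i , vtx j) ∷ chords s ++ chords t

  length-chords : ∀ {i j} (t : Tri G i j) → suc (length (chords t)) + i ≡ j
  length-chords edge = refl
  length-chords {i} (split x s t _ _) = begin
    2 + length (chords s ++ chords t) + i          ≡⟨ cong (λ k → 2 + k + i) (length-++ (chords s)) ⟩
    2 + (length (chords s) + length (chords t)) + i ≡⟨ regroup (length (chords s)) _ i ⟩
    suc (length (chords t)) + (suc (length (chords s)) + i) ≡⟨ cong (suc (length (chords t)) +_) (length-chords s) ⟩
    suc (length (chords t)) + x                    ≡⟨ length-chords t ⟩
    _                                              ∎
    where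
    open ≡-Reasoning
    regroup : ∀ a b i → 2 + (a + b) + i ≡ suc b + (suc a + i)
    regroup = solve-∀

  Inside : ℕ → ℕ → Chord → Set
  Inside i j (a , b) = i ≤ toℕ a × 2 + toℕ a ≤ toℕ b × toℕ b ≤ j × F a b ≡ false

  widen : ∀ {i i′ j j′} → i′ ≤ i → j ≤ j′ → ∀ {p} → Inside i j p → Inside i′ j′ p
  widen i′≤i j≤j′ (l , gap , u , free) = ≤-trans i′≤i l , gap , ≤-trans u j≤j′ , free

  chords-inside : ∀ {i j} (t : Tri G i j) → j < n → G i j ≡ false → All (Inside i j) (chords t)
  chords-inside edge _ _ = []
  chords-inside {i} {j} (split x s t ix xj) j<n ij =
    (≤-reflexive (sym toℕ-i) , subst₂ (λ a b → 2 + a ≤ b) (sym toℕ-i) (sym toℕ-j) (≤-trans (s≤s i<x) x<j) ,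
     ≤-reflexive toℕ-j , ij)
    ∷ All.++⁺ (All.map (widen ≤-refl (<⇒≤ x<j)) (chords-inside s (<-trans x<j j<n) ix))
              (All.map (widen (<⇒≤ i<x) ≤-refl) (chords-inside t j<n xj))
    where
    i<x = Tri⇒< s
    x<j = Tri⇒< t
    toℕ-i : toℕ (vtx {2 + m} i) ≡ i
    toℕ-i = toℕ-vtx-< (<-trans (<-trans i<x x<j) j<n)
    toℕ-j : toℕ (vtx {2 + m} j) ≡ j
    toℕ-j = toℕ-vtx-< j<n

  -- With both properties in one relation, a single induction yields non-crossing and `Unique`.
  Apart : Chord → Chord → Set
  Apart p@(a , b) q@(c , e) = ¬ Cross a b c e × p ≢ q

  apart-under : ∀ {i j p} → i < n → j < n → Inside i j p → i < toℕ (proj₁ p) ⊎ toℕ (proj₂ p) < j →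
    Apart (vtx i , vtx j) p
  apart-under {i} {j} {a , b} i<n j<n (l , gap , u , _) strict =
    (λ { ((_ , i≢a , i≢b , j≢a , j≢b , _) , inj₁ (_ , ¬b)) →
           ¬b (inj₁ (≤∧≢⇒< (≤-trans i≤a (<⇒≤ a<b)) (i≢b ∘ toℕ-injective) , ≤∧≢⇒< b≤j (j≢b ∘ sym ∘ toℕ-injective)))
       ; ((_ , i≢a , i≢b , j≢a , j≢b , _) , inj₂ (¬a , _)) →
           ¬a (inj₁ (≤∧≢⇒< i≤a (i≢a ∘ toℕ-injective) , ≤∧≢⇒< (≤-trans (<⇒≤ a<b) b≤j) (j≢a ∘ sym ∘ toℕ-injective))) }) ,
    λ { refl → [ <-irrefl (sym toℕ-i) , <-irrefl toℕ-j ] strict }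
    where
    toℕ-i : toℕ (vtx {2 + m} i) ≡ i
    toℕ-i = toℕ-vtx-< i<n
    toℕ-j : toℕ (vtx {2 + m} j) ≡ j
    toℕ-j = toℕ-vtx-< j<n
    a<b : toℕ a < toℕ b
    a<b = <⇒≤ gap
    i≤a : toℕ (vtx {2 + m} i) ≤ toℕ a
    i≤a = subst (_≤ toℕ a) (sym toℕ-i) l
    b≤j : toℕ b ≤ toℕ (vtx {2 + m} j)
    b≤j = subst (toℕ b ≤_) (sym toℕ-j) u

  apart-beside : ∀ {i x j p q} → Inside i x p → Inside x j q → Apart p q
  apart-beside {p = a , b} {c , e} (_ , gap , b≤x , _) (x≤c , gap′ , _) =
    (λ { (_ , inj₁ (bc , _)) → outside b≤c bc
       ; (_ , inj₂ (_ , be)) → outside (≤-trans b≤c (<⇒≤ (<⇒≤ gap′))) be }) ,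
    λ { refl → <⇒≱ (<⇒≤ gap) b≤c }
    where
    b≤c : toℕ b ≤ toℕ c
    b≤c = ≤-trans b≤x x≤c
    outside : ∀ {v} → toℕ b ≤ toℕ v → ¬ Between a b v
    outside b≤v (inj₁ (_ , v<b)) = <⇒≱ v<b b≤v
    outside b≤v (inj₂ (_ , v<a)) = <⇒≱ (<-trans v<a (<⇒≤ gap)) b≤v

  chords-apart : ∀ {i j} (t : Tri G i j) → j < n → G i j ≡ false → AllPairs Apart (chords t)
  -- Kept separate because `admits` lists the chords of both halves without their common root.
  chords-apart-split : ∀ {i x j} (s : Tri G i x) (t : Tri G x j) → j < n → G i x ≡ false → G x j ≡ false →
    AllPairs Apart (chords s ++ chords t)

  chords-apart edge _ _ = []
  chords-apart {i} {j} (split x s t ix xj) j<n _ =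
    All.++⁺ (All.map (λ ins → apart-under i<n j<n (widen ≤-refl (<⇒≤ x<j) ins)
               (inj₂ (≤-<-trans (proj₁ (proj₂ (proj₂ ins))) x<j)))
               (chords-inside s x<n ix))
            (All.map (λ ins → apart-under i<n j<n (widen (<⇒≤ i<x) ≤-refl ins) (inj₁ (<-≤-trans i<x (proj₁ ins))))
               (chords-inside t j<n xj))
    ∷ chords-apart-split s t j<n ix xj
    where
    i<x = Tri⇒< s
    x<j = Tri⇒< t
    x<n = <-trans x<j j<n
    i<n = <-trans i<x x<n

  chords-apart-split s t j<n ix xj =
    AllPairs.++⁺ (chords-apart s x<n ix) (chords-apart t j<n xj)
      (All.map (λ ins → All.map (apart-beside ins) (chords-inside t j<n xj)) (chords-inside s x<n ix))
    where
    x<n = <-trans (Tri⇒< t) j<n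

  -- A gap of two excludes every side except the one joining the labels 0 and n - 1, and `inner`
  -- excludes that one.
  not-boundary : ∀ {a b : Fin n} → 2 + toℕ a ≤ toℕ b → 0 < toℕ a ⊎ toℕ b < 2 + m → ¬ Boundary a b
  not-boundary {a} {b} gap inner (inj₁ b≡) = <⇒≢ gap (sym (trans (cong toℕ (trans b≡ (next≡ a)))
    (toℕ-vtx-< (<-trans gap (toℕ<n b)))))
  not-boundary {a} {b} gap inner (inj₂ a≡) with m≤n⇒m<n∨m≡n (toℕ<n b)
  ... | inj₁ 1+b<n = <⇒≢ (<-trans (<⇒≤ gap) ≤-refl) (trans (cong toℕ (trans a≡ (next≡ b))) (toℕ-vtx-< 1+b<n))
  ... | inj₂ 1+b≡n = [ (λ 0<a → <-irrefl (sym a≡0) 0<a) , (λ b<m → <-irrefl 1+b≡n (s≤s b<m)) ] inner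
    where
    a≡0 : toℕ a ≡ 0
    a≡0 = trans (cong toℕ (trans a≡ (trans (next≡ b)
            (trans (cong vtx (trans 1+b≡n (sym (+-identityʳ n)))) (vtx-periodic 0)))))
            (toℕ-vtx-< (s≤s z≤n))

  admits : (∀ a b → Boundary a b → F a b ≡ false) → Triangulable F → AdmitsTriangulation F
  admits boundary tri@(split x s t 0x xm) =
    (λ a b bd ab → true≢false ab (boundary a b bd)) ,
    -- The root chord from 0 to n - 1 is a side and is left out; n - 3 chords remain.
    chords s ++ chords t ,
    suc-injective (suc-injective (trans (sym (+-identityʳ _)) (length-chords tri))) ,
    All.++⁺ (All.map (λ { {a , b} (l , gap , u , free) →
                 <⇒≤ gap , not-boundary gap (inj₂ (≤-<-trans u x<m)) , λ ab → true≢false ab free })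
               (chords-inside s (m<n⇒m<1+n x<m) 0x))
            (All.map (λ { {a , b} (l , gap , u , free) →
                 <⇒≤ gap , not-boundary gap (inj₁ (<-≤-trans 0<x l)) , λ ab → true≢false ab free })
               (chords-inside t ≤-refl xm)) ,
    AllPairs.map proj₂ apart ,
    AllPairs.map proj₁ apart
    where
    0<x = Tri⇒< s
    x<m = Tri⇒< t
    apart : AllPairs Apart (chords s ++ chords t)
    apart = chords-apart-split s t ≤-refl 0x xm

-- The lower bound n - 2 on the number of edges

toℕ-loose : (F : Graph (2 + m)) (F-sym : Symmetric F) (sides : NoSides F) (let open Polygon F F-sym sides) →
  ∀ {x} → ¬ Tight x → walk F (suc m + toℕ (vtx {suc m} x)) (suc (toℕ (vtx {suc m} x))) ≡ false
toℕ-loose F F-sym sides {x} ¬ux = ≢true⇒≡false (¬ux ∘ Polygon.tight-cong F F-sym sides (vtx-toℕ (vtx x)))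

all-tight⇒edges : (F : Graph (5 + m)) (F-sym : Symmetric F) → Irreflexive F → (sides : NoSides F)
  (let open Polygon F F-sym sides) → (∀ c → Tight (toℕ c)) → 5 + m ≤ edges F
all-tight⇒edges {m} F F-sym F-irr sides tight = *-cancelˡ-≤ 2 (subst₂ _≤_ (*-comm (5 + m) 2)
    (trans (handshake F F-sym F-irr) (cong (edges F +_) (sym (+-identityʳ (edges F)))))
    (subst (_≤ sumF (deg F)) (sumF-const (5 + m) 2) (sumF-mono 2≤deg)))
  where
  open Polygon F F-sym sides
  chord : ∀ x → G x (2 + x) ≡ true
  chord x = tight-suc⁻ (tight-cong (vtx-toℕ (vtx (suc x))) (tight (vtx (suc x))))
  2≤deg : ∀ v → 2 ≤ deg F v
  2≤deg v = subst (2 ≤_) (trans (d-periodic (toℕ v)) (cong (deg F) (vtx-toℕ v)))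
    -- The centre is taken at n + v, so that its two neighbours n + v - 2 and n + v + 2 are natural
    -- numbers.
    (path-centre (s≤s (s≤s (s≤s (s≤s z≤n)))) (chord (3 + m + toℕ v)) (chord (5 + m + toℕ v)))

find-loose : (F : Graph (5 + m)) (F-sym : Symmetric F) → Irreflexive F → (sides : NoSides F)
  (let open Polygon F F-sym sides) → edges F < 5 + m → ∃[ x ] ¬ Tight x
find-loose F F-sym F-irr sides few with any? (λ c → ¬? (Polygon.tight? F F-sym sides (toℕ c)))
... | yes (c , loose) = toℕ c , loose
... | no  none = ⊥-elim (<⇒≱ few (all-tight⇒edges F F-sym F-irr sides
        (λ c → decidable-stable (Polygon.tight? F F-sym sides (toℕ c)) (λ loose → none (c , loose)))))

EdgeBound : ℕ → Set
EdgeBound m = (F : Graph (2 + m)) → Symmetric F → Irreflexive F → NoSides F → ¬ Triangulable F → m ≤ edges F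

ear-degree : EdgeBound m → (F : Graph (3 + m)) (F-sym : Symmetric F) → Irreflexive F → (sides : NoSides F) →
  ¬ Triangulable F → (let open Polygon F F-sym sides) → ∀ {x} → ¬ Tight x → d x + m ≤ edges F
ear-degree {m} bound F F-sym F-irr sides stuck {x} ¬ux = subst (d x + m ≤_)
    (sym (edges-deleteV F (vtx x) F-sym F-irr))
    (+-monoʳ-≤ (d x) (bound F′ (deleteV-sym F (vtx x) F-sym) (F-irr ∘ punchIn (vtx x)) deleteV-sides (stuck ∘ glue-ear)))
  where
  open Polygon F F-sym sides using (d)
  open Ear F F-sym sides (vtx x) (toℕ-loose F F-sym sides ¬ux)

-- For three and four vertices the bound n - 2 already follows from the absence of isolated
-- vertices: n ≤ 2|E(F)|.
stuck⇒degree-sum : (F : Graph (2 + m)) → Symmetric F → Irreflexive F → NoSides F → ¬ Triangulable F →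
  2 + m ≤ edges F + edges F
stuck⇒degree-sum {m} F F-sym F-irr sides stuck =
  subst₂ _≤_ (trans (sumF-const (2 + m) 1) (*-identityʳ (2 + m))) (handshake F F-sym F-irr)
    (sumF-mono (λ v → subst (λ v → 1 ≤ deg F v) (vtx-toℕ v) (no-isolated (toℕ v))))
  where open Untriangulable F F-sym F-irr sides stuck

1≤half : ∀ e → 3 ≤ e + e → 1 ≤ e
1≤half (suc e) _ = s≤s z≤n

2≤half : ∀ e → 4 ≤ e + e → 2 ≤ e
2≤half (suc zero)    (s≤s (s≤s ()))
2≤half (suc (suc e)) _ = s≤s (s≤s z≤n)

-- With n or more edges the bound is clear. With fewer, some vertex is loose, and cutting it off
-- costs at least one edge.
bound-suc : EdgeBound (2 + m) → EdgeBound (3 + m)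
bound-suc {m} bound F F-sym F-irr sides stuck with <-≤-connex (edges F) (5 + m)
... | inj₂ many = ≤-trans (m≤n+m (3 + m) 2) many
... | inj₁ few with find-loose F F-sym F-irr sides few
...   | c , ¬uc = ≤-trans (+-monoˡ-≤ (2 + m) (no-isolated c)) (ear-degree bound F F-sym F-irr sides stuck ¬uc)
  where open Untriangulable F F-sym F-irr sides stuck

stuck⇒edges : ∀ m → EdgeBound m
stuck⇒edges 0 F F-sym F-irr sides stuck = z≤n
stuck⇒edges 1 F F-sym F-irr sides stuck = 1≤half _ (stuck⇒degree-sum F F-sym F-irr sides stuck)
stuck⇒edges 2 F F-sym F-irr sides stuck = 2≤half _ (stuck⇒degree-sum F F-sym F-irr sides stuck)
stuck⇒edges (suc (suc (suc m))) = bound-suc (stuck⇒edges (suc (suc m)))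

-- Tight arcs with n - 2 or n - 1 edges

module Arc {l : ℕ} (F : Graph (5 + l)) (F-sym : Symmetric F) (F-irr : Irreflexive F) (sides : NoSides F)
           (stuck : ¬ Triangulable F) where

  open Untriangulable F F-sym F-irr sides stuck

  module _ (arc : TightArc) where
    open TightArc arc

    arc-nested : ∀ {p q i j} → w < p → p < q → q < suc (n + t) → suc t ≤ i → j < suc w →
      G p i ≡ true → G q j ≡ true → 2 + i ≤ j → ⊥
    arc-nested w<p p<q q≤n+t 1+t≤i j≤w pi qj =
      crossing-neighbours (pendant w<p (≤-trans (<⇒≤ p<q) (s≤s⁻¹ q≤n+t))) (pendant (<-trans w<p p<q) (s≤s⁻¹ q≤n+t)) pi qj
        (≤-<-trans (s≤s⁻¹ j≤w) w<p) p<q (≤-trans (s≤s⁻¹ q≤n+t) (+-monoʳ-≤ n (<⇒≤ 1+t≤i)))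

    arc-config : edges F ≡ 3 + l → ConfigF F
    arc-config size = Configuration.config F F-sym F-irr sides size 2+t≤w w<n+t chord
      (λ w<p p≤n+t → pendant w<p p≤n+t , pendant-neighbour w<p p≤n+t) arc-nested small
      where
      2≤d : ∀ {x} → d x ≢ 1 → 2 ≤ d x
      2≤d {x} dx≢1 = ≤∧≢⇒< (no-isolated x) (dx≢1 ∘ sym)
      -- In an arc of two vertices the short diagonal of each end leads to a loose vertex, whereas
      -- the neighbour of a pendant vertex is tight.
      small : 2 + t ≡ w → 2 ≤ d (suc t) × 2 ≤ d w
      small refl =
        2≤d (λ d₁ → loose ≤-refl w<n+t (pendant-neighbour-tight d₁ (chord (n≤1+n t) ≤-refl))) ,
        2≤d (λ d₂ → loose w<n+t ≤-refl (tight-cong (sym (vtx-periodic t))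
          (pendant-neighbour-tight d₂ (trans (G-sym (2 + t) t) (chord ≤-refl (n≤1+n (suc t)))))))

    -- Seen from suc w, every edge is counted at its first endpoint: the pendant vertices have at
    -- most one each, and without an extra edge so does each tight vertex, the last two having none.
    extra-edge : edges F ≡ 4 + l → ∃[ x ] ∃[ y ] (n + t < x × x < y × y ≤ n + w × y ≢ 2 + x × G x y ≡ true)
    extra-edge size with any? (λ (i : Fin n) → any? (λ (j : Fin n) →
        (n + t <? suc w + toℕ i) ×-dec (toℕ i <? toℕ j) ×-dec ¬? (toℕ j ℕ.≟ 2 + toℕ i) ×-dec
        (G (suc w + toℕ i) (suc w + toℕ j) Bool.≟ true)))
    ... | yes (i , j , l , i<j , j≢2+i , e) = suc w + toℕ i , suc w + toℕ j , l , +-monoʳ-< (suc w) i<j ,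
          subst (suc w + toℕ j ≤_) (+-comm w n) (subst (_≤ w + n) (+-suc w (toℕ j)) (+-monoʳ-≤ w (toℕ<n j))) ,
          (λ eq → j≢2+i (+-cancelˡ-≡ (suc w) _ _
            (trans eq (trans (cong suc (sym (+-suc (suc w) (toℕ i)))) (sym (+-suc (suc w) (suc (toℕ i)))))))) ,
          e
    ... | no none = ⊥-elim (<-irrefl refl (≤-trans (≤-reflexive (trans (sym size) edges-R)) (sumF≤-flat row row≤1 row≡0)))
      where
      R : Graph n
      R i j = G (suc w + toℕ i) (suc w + toℕ j)
      deg-R : ∀ i → deg R i ≡ d (suc w + toℕ i)
      deg-R i = countB-rotate (F (vtx (suc w + toℕ i))) (suc w)
      edges-R : edges F ≡ edges R
      edges-R = double-injective _ _ (trans (sym (handshake F F-sym F-irr)) (trans (sym (sumF-rotate (deg F) (suc w)))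
        (trans (sumF-cong (sym ∘ deg-R)) (handshake R (λ i j → F-sym _ _) (λ i → F-irr _)))))
      entry : Fin n → Fin n → Bool
      entry i j = (toℕ i <ᵇ toℕ j) ∧ R i j
      row : Fin n → ℕ
      row i = countB (entry i)
      entry⁻ : ∀ i j → entry i j ≡ true → toℕ i < toℕ j × R i j ≡ true
      entry⁻ i j e with toℕ i <ᵇ toℕ j in lt
      ... | true = <ᵇ⇒< _ _ (subst T (sym lt) _) , e
      only-2+ : ∀ {i} → n + t < suc w + toℕ i → ∀ j → entry i j ≡ true → toℕ j ≡ 2 + toℕ i
      only-2+ {i} far j e with i<j , ij ← entry⁻ i j e =
        decidable-stable (toℕ j ℕ.≟ 2 + toℕ i) (λ j≢ → none (i , j , far , i<j , j≢ , ij))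
      row≤1 : ∀ i → row i ≤ 1
      row≤1 i with <-≤-connex (n + t) (suc w + toℕ i)
      ... | inj₁ far  = countB≤1 (λ j j′ e e′ → toℕ-injective (trans (only-2+ far j e)
                          (sym (only-2+ far j′ e′))))
      ... | inj₂ near = ≤-trans (countB-mono (λ j e → proj₂ (entry⁻ i j e)))
                          (≤-reflexive (trans (deg-R i) (pendant (s≤s (m≤m+n w _)) near)))
      -- The last two rows belong to w - 1 and w, both tight; a short diagonal from there would
      -- leave the window. The n rows thus sum to at most n - 2, while there are n - 1 edges.
      row≡0 : ∀ i → 3 + l ≤ toℕ i → row i ≡ 0
      row≡0 i late = countB-none (λ j → ≢true⇒≡false (λ e →
          <⇒≱ (toℕ<n j) (subst (n ≤_) (sym (only-2+ far j e)) (s≤s (s≤s late)))))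
        where
        far : n + t < suc w + toℕ i
        far = subst (λ k → suc k ≤ suc w + toℕ i) (rearrange t l) (s≤s (+-mono-≤ 2+t≤w late))
          where
          rearrange : ∀ t l → 2 + t + (3 + l) ≡ 5 + l + t
          rearrange = solve-∀

    -- The extra edge joins two tight vertices and is none of the chords of the arc, so its removal
    -- keeps the chords and the pendant edges. It may make an end of the arc pendant, which `config`
    -- allows.
    removable-edge : edges F ≡ 4 + l → ∃[ a ] ∃[ b ] (E F a b × ConfigF (removeEdge F a b))
    removable-edge size with x , y , n+t<x , x<y , y≤n+w , y≢2+x , xy ← extra-edge size =
      vtx x , vtx y , xy , Configuration.config H H-sym (removeEdge-irr F _ _ F-irr)
        (λ z → cong (_∧ _) (sides z))
        (suc-injective (trans (sym (edges-removeEdge F (vtx x) (vtx y) F-sym F-irr xy)) size))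
        2+t≤w w<n+t
        (λ t≤i i<w → trans (removeEdge-other F (not-chord t≤i i<w)) (chord t≤i i<w))
        outer
        (λ l p<q u l′ u′ pi qj → arc-nested l p<q u l′ u′ (removeEdge-⊆ F _ _ _ _ pi) (removeEdge-⊆ F _ _ _ _ qj))
        (λ eq → ⊥-elim (long eq))
      where
      H : Graph n
      H = removeEdge F (vtx x) (vtx y)
      H-sym : Symmetric H
      H-sym = removeEdge-sym F (vtx x) (vtx y) F-sym
      w<x : w < x
      w<x = <-trans w<n+t n+t<x
      x≤n+w : x ≤ n + w
      x≤n+w = ≤-trans (<⇒≤ x<y) y≤n+w
      n+w<n+x : n + w < n + x
      n+w<n+x = +-monoʳ-< n w<x
      module _ {i} (t≤i : t ≤ i) (i<w : i < w) where
        wrap : ∀ {z} → w < z → z ≤ n + w → vtx {4 + l} z ≡ vtx i → z ≡ n + i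
        wrap w<z z≤n+w eq = vtx-injective (≤-<-trans z≤n+w (+-monoʳ-< n (<-≤-trans w<n+t (+-monoʳ-≤ n t≤i))))
          (+-monoʳ-< n (<-trans i<w w<z)) (trans eq (sym (vtx-periodic i)))
        not-chord : ¬ SameEdge (vtx x) (vtx y) (vtx i) (vtx (2 + i))
        not-chord (inj₁ (xi , y2+i)) = y≢2+x (vtx-injective
            (≤-<-trans y≤n+w (<-trans n+w<n+x (+-monoʳ-< n (m≤n+m (suc x) 1))))
            (+-mono-<-≤ {2} {n} (s≤s (s≤s (s≤s z≤n))) (<⇒≤ x<y)) (trans y2+i (vtx-+ 2 (sym xi))))
        not-chord (inj₂ (x2+i , yi)) = <⇒≱ x<y (≤-trans (m≤n+m y 2) (≤-reflexive (sym x≡2+y)))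
          where
          2+y<n+x : 2 + y < n + x
          2+y<n+x = ≤-<-trans (s≤s (subst (_< n + w) (sym y≡n+i) (+-monoʳ-< n i<w)))
              (subst (_< n + x) (+-suc n w) (+-monoʳ-< n (≤-<-trans w<n+t n+t<x)))
            where
            y≡n+i : y ≡ n + i
            y≡n+i = wrap (<-trans w<x x<y) y≤n+w yi
          x≡2+y : x ≡ 2 + y
          x≡2+y = vtx-injective (≤-trans x<y (≤-trans (m≤n+m y 2) (m≤n+m (2 + y) n))) 2+y<n+x
            (trans x2+i (vtx-+ 2 (sym yi)))
      outer : ∀ {p} → w < p → p ≤ n + t → deg H (vtx p) ≡ 1 × ∃[ j ] (suc t ≤ j × j ≤ w × walk H p j ≡ true)
      outer {p} w<p p≤n+t with j , 1+t≤j , j≤w , pj ← pendant-neighbour w<p p≤n+t =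
        trans (countB-cong (λ v → removeEdge-other F (away {v}))) (pendant w<p p≤n+t) ,
        j , 1+t≤j , j≤w , trans (removeEdge-other F away) pj
        where
        p≢ : ∀ {z} → n + t < z → z ≤ n + w → vtx {4 + l} z ≢ vtx p
        p≢ n+t<z z≤n+w eq = vtx-≢ (≤-<-trans p≤n+t n+t<z) (≤-<-trans z≤n+w (+-monoʳ-< n w<p)) (sym eq)
        away : ∀ {v} → ¬ SameEdge (vtx x) (vtx y) (vtx p) v
        away (inj₁ (xp , _)) = p≢ n+t<x x≤n+w xp
        away (inj₂ (_ , yp)) = p≢ (<-trans n+t<x x<y) y≤n+w yp
      -- In an arc of two vertices, x and y would be consecutive and the extra edge a side.
      long : 2 + t ≢ w
      long refl = true≢false xy (subst (λ z → G x z ≡ false) 1+x≡y (sides x))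
        where
        1+x≡y : suc x ≡ y
        1+x≡y = ≤-antisym x<y (≤-trans (subst (y ≤_) (trans (+-suc n (suc t)) (cong suc (+-suc n t))) y≤n+w) (s≤s n+t<x))

-- Here every vertex is tight, so there is no loose vertex to start an arc from. Instead, the two
-- diagonals are the only possible edges and the absence of isolated vertices forces both.
ConfigF₄ : (F : Graph 4) → Symmetric F → Irreflexive F → NoSides F → edges F ≡ 2 → ¬ Triangulable F → ConfigF F
ConfigF₄ F F-sym F-irr sides size stuck =
  s≤s (s≤s (s≤s (s≤s z≤n))) , size , isolated , zero , inj₁ (λ a b → mk⇔ (to a b) (from a b))
  where
  open Untriangulable F F-sym F-irr sides stuck
  isolated : NoIsolated F
  isolated v = subst (λ v → 1 ≤ deg F v) (vtx-toℕ v) (no-isolated (toℕ v))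
  CaseA₄ : Fin 4 → Fin 4 → Set
  CaseA₄ a b = (∃[ i ] (2 ≤ i × i ≤ 2 × SameEdge a b (shift zero 0) (shift zero i))) ⊎
               SameEdge a b (shift zero 1) (shift zero 3)
  side : ∀ a {b} → next a ≡ b → F a b ≡ false
  side a eq = trans (cong₂ F (sym (vtx-toℕ a)) (trans (sym eq) (next≡ a))) (sides (toℕ a))
  side′ : ∀ a {b} → next a ≡ b → F b a ≡ false
  side′ a eq = trans (F-sym _ a) (side a eq)
  0₄ 1₄ 2₄ 3₄ : Fin 4
  0₄ = zero
  1₄ = suc zero
  2₄ = suc (suc zero)
  3₄ = suc (suc (suc zero))
  02-edge : F 0₄ 2₄ ≡ true
  02-edge with 1≤countB⇒∃ {f = F 0₄} (isolated 0₄)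
  ... | zero , e                   = ⊥-elim (true≢false e (F-irr _))
  ... | suc zero , e               = ⊥-elim (true≢false e (side 0₄ refl))
  ... | suc (suc zero) , e         = e
  ... | suc (suc (suc zero)) , e   = ⊥-elim (true≢false e (side′ 3₄ refl))
  13-edge : F 1₄ 3₄ ≡ true
  13-edge with 1≤countB⇒∃ {f = F 1₄} (isolated 1₄)
  ... | zero , e                   = ⊥-elim (true≢false e (side′ 0₄ refl))
  ... | suc zero , e               = ⊥-elim (true≢false e (F-irr _))
  ... | suc (suc zero) , e         = ⊥-elim (true≢false e (side 1₄ refl))
  ... | suc (suc (suc zero)) , e   = e
  to : ∀ a b → E F a b → CaseA₄ a b
  to zero                   zero                   e = ⊥-elim (true≢false e (F-irr _))
  to zero                   (suc zero)             e = ⊥-elim (true≢false e (side 0₄ refl))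
  to zero                   (suc (suc zero))       e = inj₁ (2 , ≤-refl , ≤-refl , inj₁ (refl , refl))
  to zero                   (suc (suc (suc zero))) e = ⊥-elim (true≢false e (side′ 3₄ refl))
  to (suc zero)             zero                   e = ⊥-elim (true≢false e (side′ 0₄ refl))
  to (suc zero)             (suc zero)             e = ⊥-elim (true≢false e (F-irr _))
  to (suc zero)             (suc (suc zero))       e = ⊥-elim (true≢false e (side 1₄ refl))
  to (suc zero)             (suc (suc (suc zero))) e = inj₂ (inj₁ (refl , refl))
  to (suc (suc zero))       zero                   e = inj₁ (2 , ≤-refl , ≤-refl , inj₂ (refl , refl))
  to (suc (suc zero))       (suc zero)             e = ⊥-elim (true≢false e (side′ 1₄ refl))
  to (suc (suc zero))       (suc (suc zero))       e = ⊥-elim (true≢false e (F-irr _))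
  to (suc (suc zero))       (suc (suc (suc zero))) e = ⊥-elim (true≢false e (side 2₄ refl))
  to (suc (suc (suc zero))) zero                   e = ⊥-elim (true≢false e (side 3₄ refl))
  to (suc (suc (suc zero))) (suc zero)             e = inj₂ (inj₂ (refl , refl))
  to (suc (suc (suc zero))) (suc (suc zero))       e = ⊥-elim (true≢false e (side′ 2₄ refl))
  to (suc (suc (suc zero))) (suc (suc (suc zero))) e = ⊥-elim (true≢false e (F-irr _))
  from : ∀ a b → CaseA₄ a b → E F a b
  from a b (inj₁ (2 , _ , _ , inj₁ (refl , refl))) = 02-edge
  from a b (inj₁ (2 , _ , _ , inj₂ (refl , refl))) = trans (F-sym 2₄ 0₄) 02-edge
  from a b (inj₁ (1 , s≤s () , _))
  from a b (inj₁ (suc (suc (suc _)) , _ , s≤s (s≤s ()) , _))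
  from a b (inj₂ (inj₁ (refl , refl))) = 13-edge
  from a b (inj₂ (inj₂ (refl , refl))) = trans (F-sym 3₄ 1₄) 13-edge

-- Serves clause (ii) of the configuration J: deleting a loose vertex of degree two leaves n - 3
-- edges on n - 1 vertices.
stuck⇒ConfigF : (F : Graph (4 + m)) → Symmetric F → Irreflexive F → NoSides F → edges F ≡ 2 + m →
  ¬ Triangulable F → ConfigF F
stuck⇒ConfigF {zero}  F F-sym F-irr sides size stuck = ConfigF₄ F F-sym F-irr sides size stuck
stuck⇒ConfigF {suc l} F F-sym F-irr sides size stuck =
  arc-config (tight-arc loose⇒pendant (find-loose F F-sym F-irr sides (≤-trans (s≤s (≤-reflexive size)) (n≤1+n _)))) size
  where
  open Untriangulable F F-sym F-irr sides stuck
  open Arc F F-sym F-irr sides stuck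
  loose⇒pendant : ∀ x → ¬ Tight x → d x ≡ 1
  loose⇒pendant x ¬ux = ≤-antisym (+-cancelʳ-≤ (2 + l) (d x) 1
    (≤-trans (ear-degree (stuck⇒edges (2 + l)) F F-sym F-irr sides stuck ¬ux) (≤-reflexive size))) (no-isolated x)

-- A pendant edge crossing both edges of a vertex of degree two

module _ (F : Graph (2 + m)) (F-sym : Symmetric F) (F-irr : Irreflexive F) (sides : NoSides F)
         (stuck : ¬ Triangulable F) where

  open Untriangulable F F-sym F-irr sides stuck

  next-vtx : ∀ x → next (vtx {suc m} x) ≡ vtx (suc x)
  next-vtx x = trans (shift-vtx x 1) (cong vtx (+-comm x 1))

  place : ∀ (a v : Fin n) → a ≢ v → ∃[ x ] (toℕ a < x × x < n + toℕ a × vtx x ≡ v)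
  place a v a≢v with vtx-window (toℕ a) v
  ... | zero  , _   , eq = ⊥-elim (a≢v (trans (sym (vtx-toℕ a)) eq))
  ... | suc i , i≤m , eq = suc i + toℕ a , s≤s (m≤n+m _ i) , s≤s (+-monoˡ-≤ _ i≤m) , eq

  covered : ∀ {p j₁ j₂ y} → d p ≡ 2 → vtx {suc m} j₁ ≢ vtx j₂ → G p j₁ ≡ true → G p j₂ ≡ true →
    vtx {suc m} j₁ ≢ vtx y → vtx {suc m} j₂ ≢ vtx y → G p y ≡ false
  covered {p} dp j₁≢j₂ pj₁ pj₂ j₁≢y j₂≢y = ≢true⇒≡false λ py →
    [ j₁≢y ∘ sym , j₂≢y ∘ sym ] (countB≡2-cover {f = F (vtx p)} dp j₁≢j₂ pj₁ pj₂ py)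

  -- If i comes before s, both its neighbours come after s, and even after s + 1 as they are not
  -- next to s. So i has a fan over the arc from t to s + 1, and t one over the rest. If i comes
  -- after s, the mirror image works with s - 1.
  double-crossing : ∀ {t s i j₁ j₂} → t < s → t < i → i < n + t → t < j₁ → j₁ < n + t → t < j₂ → j₂ < n + t →
    d t ≡ 1 → G t s ≡ true → d i ≡ 2 → vtx {suc m} j₁ ≢ vtx j₂ → G i j₁ ≡ true → G i j₂ ≡ true →
    Splits {suc m} s i j₁ → Splits {suc m} s i j₂ →
    suc s ≢ j₁ → suc s ≢ j₂ → suc j₁ ≢ s → suc j₂ ≢ s → ⊥
  double-crossing _ _ _ _ _ _ _ _ _ _ _ _ _ (inj₁ (i<s , _)) (inj₂ (_ , s<i)) _ _ _ _ = <-asym i<s s<i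
  double-crossing _ _ _ _ _ _ _ _ _ _ _ _ _ (inj₂ (_ , s<i)) (inj₁ (i<s , _)) _ _ _ _ = <-asym i<s s<i
  double-crossing {t} {s} {i} {j₁} {j₂} t<s t<i i<n+t _ j₁<n+t _ j₂<n+t dt ts di j₁≢j₂ ij₁ ij₂
    (inj₁ (i<s , s<j₁)) (inj₁ (_ , s<j₂)) s+1≢j₁ s+1≢j₂ _ _ =
    double-fan {t} {i} {suc s} t<i (m<n⇒m<1+n i<s) (<-trans 1+s<j₁ j₁<n+t)
      (λ y l u → covered di j₁≢j₂ ij₁ ij₂ (off 1+s<j₁ j₁<n+t l u) (off (≤∧≢⇒< s<j₂ s+1≢j₂) j₂<n+t l u))
      (λ y l u → only-before dt ts l (<-trans u (+-monoʳ-< n t<s)))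
    where
    1+s<j₁ : suc s < j₁
    1+s<j₁ = ≤∧≢⇒< s<j₁ s+1≢j₁
    off : ∀ {j y} → suc s < j → j < n + t → t ≤ y → y ≤ suc s → vtx {suc m} j ≢ vtx y
    off lt j<n+t t≤y y≤1+s eq = vtx-≢ (≤-<-trans y≤1+s lt) (<-≤-trans j<n+t (+-monoʳ-≤ n t≤y)) (sym eq)
  -- The neighbour of t is now called `suc s`, so the fans meet just before it, at s one turn on; i
  -- comes first and t is met at n + t.
  double-crossing {t} {suc s} {i} {j₁} {j₂} t<s t<i i<n+t t<j₁ _ t<j₂ _ dt ts di j₁≢j₂ ij₁ ij₂
    (inj₂ (j₁<s , s<i)) (inj₂ (j₂<s , _)) _ _ j₁+1≢s j₂+1≢s =
    double-fan {i} {n + t} {n + s} i<n+t (+-monoʳ-< n (<-trans t<j₁ j₁<s′)) (+-monoʳ-< n (<-trans ≤-refl s<i))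
      (λ y l u → trans (G-periodicˡ t y) (only-before dt ts (<-≤-trans s<i l) (≤-<-trans u (+-monoʳ-< n ≤-refl))))
      (λ y l u → covered di j₁≢j₂ ij₁ ij₂ (off j₁<s′ t<j₁ l u) (off (s≤s⁻¹ (≤∧≢⇒< j₂<s j₂+1≢s)) t<j₂ l u))
    where
    j₁<s′ : j₁ < s
    j₁<s′ = s≤s⁻¹ (≤∧≢⇒< j₁<s j₁+1≢s)
    off : ∀ {j y} → j < s → t < j → n + s ≤ y → y < n + i → vtx {suc m} j ≢ vtx y
    off {j} lt t<j n+s≤y y<n+i eq = vtx-≢ (<-≤-trans (+-monoʳ-< n lt) n+s≤y)
      (<-trans y<n+i (+-monoʳ-< n (<-trans i<n+t (+-monoʳ-< n t<j)))) (trans (vtx-periodic j) eq)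

  double-pendant-crossing : ∀ i j₁ j₂ t s → deg F i ≡ 2 → j₁ ≢ j₂ → E F i j₁ → E F i j₂ →
    deg F t ≡ 1 → E F t s → Cross t s i j₁ → Cross t s i j₂ → Boundary j₁ s ⊎ Boundary j₂ s
  double-pendant-crossing i j₁ j₂ t s di j₁≢j₂ ij₁ ij₂ dt ts cross₁ cross₂ =
    decidable-stable (boundary? j₁ s ⊎-dec boundary? j₂ s) λ none →
      apart (vtx-toℕ t) di j₁≢j₂ ij₁ ij₂ dt ts cross₁ cross₂ (none ∘ inj₁) (none ∘ inj₂)
    where
    boundary? : ∀ (a b : Fin n) → Dec (Boundary a b)
    boundary? a b = (b ≟ next a) ⊎-dec (a ≟ next b)
    apart : ∀ {i j₁ j₂ t s} → vtx (toℕ t) ≡ t → deg F i ≡ 2 → j₁ ≢ j₂ → E F i j₁ → E F i j₂ →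
      deg F t ≡ 1 → E F t s → Cross t s i j₁ → Cross t s i j₂ → ¬ Boundary j₁ s → ¬ Boundary j₂ s → ⊥
    apart {i} {j₁} {j₂} {t} {s} vtx-τ di j₁≢j₂ ij₁ ij₂ dt ts
          cross₁@((t≢s , t≢i , t≢j₁ , _) , _) cross₂@((_ , _ , t≢j₂ , _) , _) ¬b₁ ¬b₂
      with σ , τ<σ , σ<n , refl ← place t s t≢s
      with ι , τ<ι , ι<n , refl ← place t i t≢i
      with γ₁ , τ<γ₁ , γ₁<n , refl ← place t j₁ t≢j₁
      with γ₂ , τ<γ₂ , γ₂<n , refl ← place t j₂ t≢j₂
      = double-crossing τ<σ τ<ι ι<n τ<γ₁ γ₁<n τ<γ₂ γ₂<n
          (trans (cong (deg F) vtx-τ) dt) (trans (cong (λ v → F v (vtx σ)) vtx-τ) ts) di j₁≢j₂ ij₁ ij₂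
          (splits τ<γ₁ γ₁<n cross₁) (splits τ<γ₂ γ₂<n cross₂)
          (λ eq → ¬b₁ (inj₂ (after eq))) (λ eq → ¬b₂ (inj₂ (after eq)))
          (λ eq → ¬b₁ (inj₁ (after eq))) (λ eq → ¬b₂ (inj₁ (after eq)))
      where
      after : ∀ {x y} → suc x ≡ y → vtx y ≡ next (vtx {suc m} x)
      after {x} refl = sym (next-vtx x)
      splits : ∀ {γ} → toℕ t < γ → γ < n + toℕ t → Cross t (vtx σ) (vtx ι) (vtx γ) → Splits {suc m} σ ι γ
      splits τ<γ γ<n cross = cross⇒splits τ<σ σ<n τ<ι ι<n τ<γ γ<n
        (subst (λ v → Cross v (vtx σ) (vtx ι) (vtx _)) (sym vtx-τ) cross)

-- Assembling the configuration J and its two types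

untriangulable⇒ConfigJ : ∀ l (F : Graph (5 + l)) → Symmetric F → Irreflexive F → NoSides F → edges F ≡ 4 + l →
  ¬ Triangulable F → ConfigJ F × (Type1 F ⊎ Type2 F)
untriangulable⇒ConfigJ l F F-sym F-irr sides size stuck =
  (s≤s (s≤s (s≤s (s≤s (s≤s z≤n)))) , size , no-isolated′ , degree≤2 , deleted) , types
  where
  open Untriangulable F F-sym F-irr sides stuck
  open Arc F F-sym F-irr sides stuck
  no-isolated′ : NoIsolated F
  no-isolated′ v = subst (λ v → 1 ≤ deg F v) (vtx-toℕ v) (no-isolated (toℕ v))
  loose : ∀ i → ¬ E F (prev i) (next i) → ¬ Tight (toℕ i)
  loose i ¬e u = ¬e (trans (cong₂ F (prev≡ i) (next≡ i)) u)
  loose-degree : ∀ x → ¬ Tight x → d x ≤ 2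
  loose-degree x ¬ux = +-cancelʳ-≤ (2 + l) (d x) 2
    (≤-trans (ear-degree (stuck⇒edges (2 + l)) F F-sym F-irr sides stuck ¬ux) (≤-reflexive size))
  degree≤2 : ∀ i → ¬ E F (prev i) (next i) → deg F i ≤ 2
  degree≤2 i ¬e = subst (λ v → deg F v ≤ 2) (vtx-toℕ i) (loose-degree (toℕ i) (loose i ¬e))
  deleted : ∀ i → ¬ E F (prev i) (next i) → deg F i ≡ 2 → ConfigF (deleteV F i)
  deleted i ¬e di = stuck⇒ConfigF (deleteV F i) (deleteV-sym F i F-sym) (F-irr ∘ punchIn i) deleteV-sides
      (+-cancelˡ-≡ 2 _ _ (trans (cong (_+ edges (deleteV F i)) (sym di))
        (trans (sym (edges-deleteV F i F-sym F-irr)) size)))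
      (stuck ∘ glue-ear)
    where open Ear F F-sym sides i (≢true⇒≡false (loose i ¬e))
  types : Type1 F ⊎ Type2 F
  -- The types are told apart by whether J_{n,2} is empty. If it is, the degree bound two drops to
  -- one at every loose vertex, and these are the pendant vertices that `tight-arc` asks for.
  types with any? (λ i → (deg F i ℕ.≟ 2) ×-dec ¬? (F (prev i) (next i) Bool.≟ true))
  ... | yes found = inj₂ (found , λ i j₁ j₂ t s (di , _) →
      double-pendant-crossing F F-sym F-irr sides stuck i j₁ j₂ t s di)
  ... | no  none  = inj₁ ((λ i i∈J → none (i , i∈J)) , removable-edge arc size)
    where
    loose⇒pendant : ∀ x → ¬ Tight x → d x ≡ 1
    loose⇒pendant x ¬ux = ≤-antisym (s≤s⁻¹ (≤∧≢⇒< (loose-degree x ¬ux) λ dx≡2 → none (vtx x , dx≡2 ,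
      λ e → ¬ux (tight-cong (vtx-toℕ (vtx x)) (trans (sym (cong₂ F (prev≡ (vtx x)) (next≡ (vtx x)))) e)))))
      (no-isolated x)
    arc : TightArc
    arc = tight-arc loose⇒pendant (find-loose F F-sym F-irr sides (≤-reflexive (cong suc size)))

theorem3 : (n : ℕ) → 5 ≤ n → (F : Graph n) → Symmetric F → Irreflexive F →
    edges F ≡ n ∸ 1 → (∀ a b → Boundary a b → F a b ≡ false) →
    ¬ (ConfigJ F × (Type1 F ⊎ Type2 F)) → AdmitsTriangulation F
theorem3 (suc (suc (suc (suc (suc l))))) (s≤s (s≤s (s≤s (s≤s (s≤s z≤n))))) F F-sym F-irr size boundary notJ =
  Diagonals.admits F F-sym sides boundary
    (decidable-stable (Tri? (walk F) 0 (4 + l)) (notJ ∘ untriangulable⇒ConfigJ l F F-sym F-irr sides size))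
  where
  sides : NoSides F
  sides x = boundary (vtx x) (vtx (suc x)) (inj₁ (sym (trans (shift-vtx x 1) (cong vtx (+-comm x 1)))))
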